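{- Let $n\ge1$ and let $\alpha_1,\dots,\alpha_{2n-1}\ge 0$ be integers with $\alpha_i=1$ for all even $i$. Let $G_A=G_X(\alpha_1,\alpha_2,\dots,\alpha_{2n-1})$ and $G_B=G_X(\alpha_1+1,\alpha_3+1,\dots,\alpha_{2n-1}+1)$; both graphs have $N:=n+\sum_{1\le i<j\le n}(\alpha_{2i-1}+1)(\alpha_{2j-1}+1)$ vertices. Fix any distinct $p_1,p_3,\dots,p_{2n-1}\in[N]$ and let $$A:=\{f\in\mathrm{Topo}(G_A): f(u_i)=p_i \text{ for all odd } i\},\qquad B:=\{f\in\mathrm{Topo}(G_B): f(u_i)=p_{2i-1}\text{ for all } i\in[n]\}.$$ Then there is a bijection $$\Big[\big(\textstyle\sum_{i=1}^{2n-1}\alpha_i\big)!\Big]\times A\;\longleftrightarrow\;\prod_{i=1}^{2n-1}[\alpha_i!]\times B.$$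
   Context: $[m]=\{1,\dots,m\}$. For a directed acyclic graph $G=(V,E)$, a topological ordering is a bijection $f:V\to[|V|]$ with $f(u)>f(v)$ for every edge $u\to v$, and $\mathrm{Topo}(G)$ is the set of topological orderings. For a tuple $\alpha=(\alpha_1,\dots,\alpha_m)$ of nonnegative integers, $G_X(\alpha)$ is the directed graph with vertices $u_1,\dots,u_m$ and $w_{i,j,k}$ for $1\le i<j\le m$, $k\in[\alpha_i\alpha_j]$, and edges $u_{i+1}\to u_i$ for $i\in[m-1]$ and $u_j\to w_{i,j,k}\to u_i$ for all $1\le i<j\le m$, $k\in[\alpha_i\alpha_j]$. -}

module Defs where

open import Level using (0ℓ)
open import Data.Nat using (ℕ; zero; suc; _+_; _*_; _∸_; _≤_; _<_; s≤s; z≤n)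
open import Data.Nat.Properties using (≤-trans; ≤-refl; *-monoʳ-≤; +-suc; n≤1+n)
open import Data.Fin.Properties using (toℕ<n)
open import Data.Fin using (Fin; toℕ; fromℕ<) renaming (zero to fzero; suc to fsuc)
open import Data.Product using (Σ; _×_; _,_; proj₁; proj₂)
open import Function.Definitions using (Bijective)
open import Relation.Binary.Bundles using (Setoid)
open import Relation.Binary.PropositionalEquality using (_≡_; refl; sym; trans; cong; subst)
import Relation.Binary.PropositionalEquality as ≡

sumF : {m : ℕ} → (Fin m → ℕ) → ℕ
sumF {zero}  a = 0
sumF {suc m} a = a fzero + sumF (λ i → a (fsuc i))

pairSum : {m : ℕ} → (Fin m → ℕ) → ℕ
pairSum {zero}  a = 0
pairSum {suc m} a = a fzero * sumF (λ i → a (fsuc i)) + pairSum (λ i → a (fsuc i))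

-- The graph G_X(α), α = (α_1,…,α_m), indices shifted to Fin m (0-based)

data Vert (m : ℕ) (α : Fin m → ℕ) : Set where
  u : Fin m → Vert m α
  w : (i j : Fin m) → toℕ i < toℕ j → Fin (α i * α j) → Vert m α

data Edge {m : ℕ} {α : Fin m → ℕ} : Vert m α → Vert m α → Set where
  uu : (i j : Fin m) → toℕ j ≡ suc (toℕ i) → Edge (u j) (u i)
  uw : (i j : Fin m) (p : toℕ i < toℕ j) (k : Fin (α i * α j)) → Edge (u j) (w i j p k)
  wu : (i j : Fin m) (p : toℕ i < toℕ j) (k : Fin (α i * α j)) → Edge (w i j p k) (u i)

vcount : (m : ℕ) → (Fin m → ℕ) → ℕ
vcount m α = m + pairSum α

-- f : V → [|V|] (positions 0-based) is a topological ordering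
IsTopo : {m : ℕ} {α : Fin m → ℕ} → (Vert m α → Fin (vcount m α)) → Set
IsTopo {m} {α} f =
  Bijective _≡_ _≡_ f × (∀ x y → Edge x y → toℕ (f y) < toℕ (f x))

Topo : (m : ℕ) → (Fin m → ℕ) → Set
Topo m α = Σ (Vert m α → Fin (vcount m α)) IsTopo

-- Index 2k (0-based), i.e. the odd index 2k+1 (1-based), in Fin (2n-1)

double<  : (n k : ℕ) → k < n → 2 * k < 2 * n ∸ 1
double< (suc n) zero _ = subst (λ t → 0 < t) (sym (+-suc n (n + 0))) (s≤s z≤n)
double< (suc (suc n)) (suc k) (s≤s k<n) = helper
  where
    ih : 2 * k < 2 * suc n ∸ 1
    ih = double< (suc n) k k<n
    eq1 : 2 * suc k ≡ suc (suc (2 * k))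
    eq1 = cong suc (+-suc k (k + 0))
    eq2 : 2 * suc (suc n) ∸ 1 ≡ suc (suc (2 * suc n ∸ 1))
    eq2 = cong suc (+-suc n (suc n + 0))
    helper : 2 * suc k < 2 * suc (suc n) ∸ 1
    helper = subst (λ t → 2 * suc k < t) (sym eq2)
               (subst (λ t → t < suc (suc (2 * suc n ∸ 1))) (sym eq1) (s≤s (s≤s ih)))

oddIdx : {n : ℕ} → Fin n → Fin (2 * n ∸ 1)
oddIdx {n} k = fromℕ< (double< n (toℕ k) (toℕ<n k))

αB : (n : ℕ) → (Fin (2 * n ∸ 1) → ℕ) → Fin n → ℕ
αB n α k = suc (α (oddIdx k))

Ncount : (n : ℕ) → (Fin (2 * n ∸ 1) → ℕ) → ℕ
Ncount n α = n + pairSum (αB n α)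

SetA : (n : ℕ) (α : Fin (2 * n ∸ 1) → ℕ) → (Fin n → Fin (Ncount n α)) → Set
SetA n α p = Σ (Topo (2 * n ∸ 1) α) λ t →
  ∀ (k : Fin n) → toℕ (proj₁ t (u (oddIdx k))) ≡ toℕ (p k)

SetB : (n : ℕ) (α : Fin (2 * n ∸ 1) → ℕ) → (Fin n → Fin (Ncount n α)) → Set
SetB n α p = Σ (Topo n (αB n α)) λ t →
  ∀ (k : Fin n) → toℕ (proj₁ t (u k)) ≡ toℕ (p k)

topoSetoid : {S : Set} {V : Set} {N : ℕ} → (S → V → Fin N) → Setoid 0ℓ 0ℓ
topoSetoid {S} {V} get = record
  { Carrier = S
  ; _≈_ = λ x y → ∀ v → get x v ≡ get y v
  ; isEquivalence = record
    { refl = λ v → refl ; sym = λ e v → sym (e v) ; trans = λ e f v → trans (e v) (f v) } }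

A-setoid : (n : ℕ) (α : Fin (2 * n ∸ 1) → ℕ) (p : Fin n → Fin (Ncount n α)) → Setoid 0ℓ 0ℓ
A-setoid n α p = topoSetoid {SetA n α p} (λ x → proj₁ (proj₁ x))

B-setoid : (n : ℕ) (α : Fin (2 * n ∸ 1) → ℕ) (p : Fin n → Fin (Ncount n α)) → Setoid 0ℓ 0ℓ
B-setoid n α p = topoSetoid {SetB n α p} (λ x → proj₁ (proj₁ x))

Π-Fin-setoid : {m : ℕ} → (Fin m → ℕ) → Setoid 0ℓ 0ℓ
Π-Fin-setoid {m} a = record
  { Carrier = (i : Fin m) → Fin (a i)
  ; _≈_ = λ x y → ∀ i → x i ≡ y i
  ; isEquivalence = record
    { refl = λ v → refl ; sym = λ e v → sym (e v) ; trans = λ e f v → trans (e v) (f v) } }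

{-# OPTIONS --safe #-}
module Submission where

-- Work in ℤ[z_t]/(z_t²), one variable per position, with X_t = Σ_{s<t} z_s. The number of
-- topological orderings with f(u_i) = P_i is the coefficient of Π_t z_t in
-- Π_i z_{P_i} · Π_{i<j} (X_{P_j} − X_{P_i})^{α_i α_j}. Summing over the positions of the even u's
-- turns A into an iterated integral ∫ Π_i W(x_i) Δ(x) dx with x_i between the odd points
-- a_i = X_{p_i}, where ∫ f means Σ_t z_t f(X_t), W(x) = Π_j (x − a_j)^{α_j} and Δ is the Vandermonde
-- product; since z_t² = 0, the fundamental theorem of calculus holds exactly. The theorem is then the
-- Dixon–Anderson evaluation of this integral. It follows from Lagrange interpolation:
-- S Δ(c,x) = Σ_k ± Q(x_k) Δ(c,x without x_k) for Q = (W Π_j (x − a_j))′ / W of leading coefficient S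
-- (x_0 = c), where all terms with k ≥ 1 integrate to 0 because W Q is a derivative vanishing at the
-- a_j. Taking c = a_l raises α_l by one; for α = 0 a similar step removes one variable. Signs are
-- not tracked, since both sides finally count something.

open import Defs
open import Algebra.Bundles using (CommutativeRing)
import Algebra.Properties.CommutativeMonoid.Sum as CommutativeMonoidSum
import Algebra.Properties.Semiring.Sum as SemiringSum
import Algebra.Solver.Ring as RingSolver
import Algebra.Solver.Ring.AlmostCommutativeRing as ACR
open import Algebra.Structures using (IsCommutativeRing)
open import Data.Bool using (Bool; true; false; if_then_else_; not; _∧_)
open import Data.Empty using (⊥; ⊥-elim)
open import Data.Fin using (Fin; zero; suc; toℕ; inject₁; _↑ˡ_; _↑ʳ_; splitAt; combine; remQuot; punchIn; punchOut)
import Data.Fin.Permutation as Perm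
import Data.Fin.Properties as Fin
open import Data.Integer as ℤ using (ℤ)
import Data.Integer.Properties as ℤ
open import Data.List using (List; []; _∷_; [_]; length; _++_; map; tabulate)
import Data.List.Properties as List
open import Data.List.Relation.Unary.All as All using (All; []; _∷_)
open import Data.Maybe using (Maybe; just; nothing)
open import Data.Nat using (ℕ; zero; suc; pred; _+_; _*_; _∸_; _≤_; _<_; _!; z≤n; s≤s; s≤s⁻¹; _≡ᵇ_; _<ᵇ_; _≤?_)
import Data.Nat.Properties as ℕ
open import Data.Nat.Solver using (module +-*-Solver)
open import Data.Product using (Σ; ∃; _×_; _,_; proj₁; proj₂)
open import Data.Product.Relation.Binary.Pointwise.NonDependent using (×-setoid)
open import Data.Sum as Sum using (_⊎_; inj₁; inj₂; [_,_]′)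
import Data.Vec.Functional as Vector
open import Function using (_∘_)
open import Function.Bundles using (Bijection)
open import Function.Definitions using (Injective)
open import Level using (0ℓ)
open import Relation.Binary.Bundles using (Setoid)
open import Relation.Binary.PropositionalEquality using (_≡_; _≢_; refl; sym; trans; cong; cong₂; subst; subst₂; setoid; isEquivalence; module ≡-Reasoning)
open import Relation.Nullary using (yes; no)
open ≡-Reasoning

-- The bijection is obtained from a count, (Σ α_i)! · |A| = Π α_i! · |B|, so what is needed is an
-- identity of top coefficients in a single ring, which makes sense because both graphs have N
-- vertices. Bijectivity costs nothing in this ring: positions may be chosen independently, since a
-- collision produces some z_t² = 0 and a top coefficient survives only if every position is used
-- once. Integers are not invertible there, so the evaluation is stated with cleared denominators:
-- (S - 1)! times the integral equals, up to sign, Π α_j! times Π (a_i - a_j)^(α_i + α_j + 1) over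
-- the odd indices, where S = Σ (α_j + 1). Two numerical coincidences link this to the theorem: S -
-- 1 is the sum of all α_i, because the n - 1 even ones are 1; and α_i α_j + (α_i + α_j + 1) = (α_i
-- + 1)(α_j + 1), which turns the exponents of G_A into those of G_B. If p_1, p_3, ... are not in
-- increasing order, the integral no longer counts anything, but then A and B are both empty; that
-- case is separated at the very end.

-- Commutative rings with a structure map from ℤ

record ℤ-Algebra : Set₁ where
  infixl 6 _⊕_ _⊝_
  infixl 7 _⊗_
  infix  8 ⊖_
  field
    Carrier : Set
    _⊕_ _⊗_ : Carrier → Carrier → Carrier
    ⊖_      : Carrier → Carrier
    ι       : ℤ → Carrier
    isCommutativeRing : IsCommutativeRing _≡_ _⊕_ _⊗_ ⊖_ (ι ℤ.0ℤ) (ι ℤ.1ℤ)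
    ι-+     : ∀ a b → ι (a ℤ.+ b) ≡ ι a ⊕ ι b
    ι-*     : ∀ a b → ι (a ℤ.* b) ≡ ι a ⊗ ι b
    ι-neg   : ∀ a → ι (ℤ.- a) ≡ ⊖ ι a

  𝟘 𝟙 : Carrier
  𝟘 = ι ℤ.0ℤ
  𝟙 = ι ℤ.1ℤ

  commutativeRing : CommutativeRing 0ℓ 0ℓ
  commutativeRing = record { isCommutativeRing = isCommutativeRing }

  _⊝_ : Carrier → Carrier → Carrier
  x ⊝ y = x ⊕ ⊖ y

module Solver (R : ℤ-Algebra) where
  open ℤ-Algebra R

  acr : ACR.AlmostCommutativeRing 0ℓ 0ℓ
  acr = ACR.fromCommutativeRing commutativeRing

  -- Solver coefficients lie in ℤ, so that integer constants are combined; 𝟘 and 𝟙 are images under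
  -- `ι` by definition, which makes both unit laws `refl`.
  ι-morphism : CommutativeRing.rawRing ℤ.+-*-commutativeRing ACR.-Raw-AlmostCommutative⟶ acr
  ι-morphism = record
    { ⟦_⟧ = ι ; +-homo = ι-+ ; *-homo = ι-* ; -‿homo = ι-neg ; 0-homo = refl ; 1-homo = refl }

  ι-≟ : ∀ a b → Maybe (ι a ≡ ι b)
  ι-≟ a b with a ℤ.≟ b
  ... | yes a≡b = just (cong ι a≡b)
  ... | no  _   = nothing

  open RingSolver (CommutativeRing.rawRing ℤ.+-*-commutativeRing) acr ι-morphism ι-≟ public
    using (solve; _:=_; _:+_; _:*_; _:-_; :-_; con; Polynomial)

  :0 :1 : ∀ {n} → Polynomial n
  :0 = con ℤ.0ℤ
  :1 = con ℤ.1ℤ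

-- Dual numbers and the squarefree ring

module _ (R : ℤ-Algebra) where
  open ℤ-Algebra R
  open CommutativeRing commutativeRing
    using (+-assoc; +-comm; +-identityˡ; +-identityʳ; -‿inverseˡ; -‿inverseʳ)
  open Solver R

  private
    D : Set
    D = Carrier × Carrier

    _+ᴰ_ _*ᴰ_ : D → D → D
    (a , b) +ᴰ (c , d) = a ⊕ c , b ⊕ d
    (a , b) *ᴰ (c , d) = a ⊗ c , a ⊗ d ⊕ b ⊗ c

    -ᴰ_ : D → D
    -ᴰ (a , b) = ⊖ a , ⊖ b

    0ᴰ 1ᴰ : D
    0ᴰ = 𝟘 , 𝟘
    1ᴰ = 𝟙 , 𝟘

    *-commᴰ : ∀ x y → x *ᴰ y ≡ y *ᴰ x
    *-commᴰ (a , b) (c , d) = cong₂ _,_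
      (solve 2 (λ a c → a :* c := c :* a) refl a c)
      (solve 4 (λ a b c d → a :* d :+ b :* c := c :* b :+ d :* a) refl a b c d)

    identityˡᴰ : ∀ x → 1ᴰ *ᴰ x ≡ x
    identityˡᴰ (a , b) = cong₂ _,_ (solve 1 (λ a → :1 :* a := a) refl a)
      (solve 2 (λ a b → :1 :* b :+ :0 :* a := b) refl a b)

    distribˡᴰ : ∀ x y z → x *ᴰ (y +ᴰ z) ≡ (x *ᴰ y) +ᴰ (x *ᴰ z)
    distribˡᴰ (a , b) (c , d) (e , f) = cong₂ _,_
      (solve 3 (λ a c e → a :* (c :+ e) := a :* c :+ a :* e) refl a c e)
      (solve 6 (λ a b c d e f → a :* (d :+ f) :+ b :* (c :+ e)
                             := a :* d :+ b :* c :+ (a :* f :+ b :* e)) refl a b c d e f)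

    isCommutativeRingᴰ : IsCommutativeRing _≡_ _+ᴰ_ _*ᴰ_ -ᴰ_ 0ᴰ 1ᴰ
    isCommutativeRingᴰ = record
      { isRing = record
        { +-isAbelianGroup = record
          { isGroup = record
            { isMonoid = record
              { isSemigroup = record
                { isMagma = record { isEquivalence = isEquivalence ; ∙-cong = cong₂ _+ᴰ_ }
                ; assoc = λ (a , b) (c , d) (e , f) → cong₂ _,_ (+-assoc a c e) (+-assoc b d f) }
              ; identity = (λ (a , b) → cong₂ _,_ (+-identityˡ a) (+-identityˡ b))
                         , (λ (a , b) → cong₂ _,_ (+-identityʳ a) (+-identityʳ b)) }
            ; inverse = (λ (a , b) → cong₂ _,_ (-‿inverseˡ a) (-‿inverseˡ b))
                      , (λ (a , b) → cong₂ _,_ (-‿inverseʳ a) (-‿inverseʳ b))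
            ; ⁻¹-cong = cong -ᴰ_ }
          ; comm = λ (a , b) (c , d) → cong₂ _,_ (+-comm a c) (+-comm b d) }
        ; *-cong = cong₂ _*ᴰ_
        ; *-assoc = λ (a , b) (c , d) (e , f) → cong₂ _,_
            (solve 3 (λ a c e → a :* c :* e := a :* (c :* e)) refl a c e)
            (solve 6 (λ a b c d e f → a :* c :* f :+ (a :* d :+ b :* c) :* e
                                   := a :* (c :* f :+ d :* e) :+ b :* (c :* e)) refl a b c d e f)
        ; *-identity = identityˡᴰ , (λ x → trans (*-commᴰ x 1ᴰ) (identityˡᴰ x))
        ; distrib = distribˡᴰ , (λ x y z → trans (*-commᴰ (y +ᴰ z) x)
                                   (trans (distribˡᴰ x y z) (cong₂ _+ᴰ_ (*-commᴰ x y) (*-commᴰ x z)))) }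
      ; *-comm = *-commᴰ }

  -- The ring R[z]/(z²), with `(a , b)` standing for a + b z. Iterating it adjoins one variable per
  -- position.
  dual : ℤ-Algebra
  dual = record
    { isCommutativeRing = isCommutativeRingᴰ
    ; ι     = λ a → ι a , 𝟘
    ; ι-+   = λ a b → cong₂ _,_ (ι-+ a b) (sym (+-identityʳ 𝟘))
    ; ι-*   = λ a b → cong₂ _,_ (ι-* a b)
                (solve 2 (λ a b → :0 := a :* :0 :+ :0 :* b) refl (ι a) (ι b))
    ; ι-neg = λ a → cong₂ _,_ (ι-neg a) (solve 0 (:0 := :- :0) refl) }

ℤ-algebra : ℤ-Algebra
ℤ-algebra = record
  { isCommutativeRing = CommutativeRing.isCommutativeRing ℤ.+-*-commutativeRing
  ; ι = λ a → a ; ι-+ = λ _ _ → refl ; ι-* = λ _ _ → refl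
  ; ι-neg = λ _ → refl }

-- ℤ[z₀,…,z_{N−1}]/(z₀²,…,z_{N−1}²).
Squarefree : ℕ → ℤ-Algebra
Squarefree zero    = ℤ-algebra
Squarefree (suc N) = dual (Squarefree N)

module Sq (N : ℕ) = ℤ-Algebra (Squarefree N)

-- Variables beyond the last one are 0.
var : ∀ N → ℕ → Sq.Carrier N
var zero    _       = ℤ.0ℤ
var (suc N) zero    = Sq.𝟘 N , Sq.𝟙 N
var (suc N) (suc t) = var N t , Sq.𝟘 N

-- The coefficient of z₀⋯z_{N−1}.
top : ∀ N → Sq.Carrier N → ℤ
top zero    x       = x
top (suc N) (_ , x) = top N x

-- Vandermonde products and division-free Lagrange interpolation

module Vandermonde (R : ℤ-Algebra) where
  open ℤ-Algebra R renaming (Carrier to C)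
  open Solver R

  prod : {A : Set} → (A → C) → List A → C
  prod c []       = 𝟙
  prod c (x ∷ xs) = c x ⊗ prod c xs

  Δ : List C → C
  Δ []       = 𝟙
  Δ (x ∷ xs) = prod (x ⊝_) xs ⊗ Δ xs

  -- Σₖ (−1)ᵏ f xₖ (x₀ … x̂ₖ … xₘ)
  altSum : (C → List C → C) → List C → C
  altSum f []       = 𝟘
  altSum f (x ∷ xs) = f x xs ⊝ altSum (λ y ys → f y (x ∷ ys)) xs

  altSum-cong : ∀ {f g} xs → (∀ y ys → suc (length ys) ≡ length xs → f y ys ≡ g y ys) →
                altSum f xs ≡ altSum g xs
  altSum-cong []       f≗g = refl
  altSum-cong (x ∷ xs) f≗g = cong₂ _⊝_ (f≗g x xs refl)
    (altSum-cong xs (λ y ys e → f≗g y (x ∷ ys) (cong suc e)))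

  altSum-linear : ∀ a b f g xs → altSum (λ y ys → a ⊗ f y ys ⊕ b ⊗ g y ys) xs
                               ≡ a ⊗ altSum f xs ⊕ b ⊗ altSum g xs
  altSum-linear a b f g [] = solve 2 (λ a b → :0 := a :* :0 :+ b :* :0) refl a b
  altSum-linear a b f g (x ∷ xs) = trans
    (cong (a ⊗ f x xs ⊕ b ⊗ g x xs ⊝_)
      (altSum-linear a b (λ y ys → f y (x ∷ ys)) (λ y ys → g y (x ∷ ys)) xs))
    (solve 6 (λ a b p q r s → a :* p :+ b :* q :- (a :* r :+ b :* s)
                           := a :* (p :- r) :+ b :* (q :- s)) refl a b (f x xs) (g x xs) _ _)

  altSum-+ : ∀ f g xs → altSum (λ y ys → f y ys ⊕ g y ys) xs ≡ altSum f xs ⊕ altSum g xs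
  altSum-+ f g [] = solve 0 (:0 := :0 :+ :0) refl
  altSum-+ f g (x ∷ xs) = trans
    (cong (f x xs ⊕ g x xs ⊝_) (altSum-+ (λ y ys → f y (x ∷ ys)) (λ y ys → g y (x ∷ ys)) xs))
    (solve 4 (λ p q r s → p :+ q :- (r :+ s) := p :- r :+ (q :- s)) refl (f x xs) (g x xs) _ _)

  altSum-* : ∀ a f xs → altSum (λ y ys → a ⊗ f y ys) xs ≡ a ⊗ altSum f xs
  altSum-* a f [] = solve 1 (λ a → :0 := a :* :0) refl a
  altSum-* a f (x ∷ xs) = trans
    (cong (a ⊗ f x xs ⊝_) (altSum-* a (λ y ys → f y (x ∷ ys)) xs))
    (solve 3 (λ a p r → a :* p :- a :* r := a :* (p :- r)) refl a (f x xs) _)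

  altSum-zero : ∀ {f} xs → (∀ y ys → suc (length ys) ≡ length xs → f y ys ≡ 𝟘) →
                altSum f xs ≡ 𝟘
  altSum-zero []       f≗0 = refl
  altSum-zero (x ∷ xs) f≗0 = trans
    (cong₂ _⊝_ (f≗0 x xs refl) (altSum-zero xs (λ y ys e → f≗0 y (x ∷ ys) (cong suc e))))
    (solve 0 (:0 :- :0 := :0) refl)

  -- Whichever point y is removed, `c y ⊗ prod c ys` is the product over the whole list and can
  -- leave the sum.
  altSum-prod : ∀ c h xs → altSum (λ y ys → c y ⊗ prod c ys ⊗ h y ys) xs
                         ≡ prod c xs ⊗ altSum h xs
  altSum-prod c h [] = solve 0 (:0 := :1 :* :0) refl
  altSum-prod c h (x ∷ xs) = begin
    p ⊗ h x xs ⊝ altSum (λ y ys → c y ⊗ (c x ⊗ prod c ys) ⊗ h y (x ∷ ys)) xs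
      ≡⟨ cong (p ⊗ h x xs ⊝_) (altSum-cong xs λ y ys _ →
           solve 4 (λ a b p h → a :* (b :* p) :* h := b :* (a :* p :* h)) refl
             (c y) (c x) (prod c ys) (h y (x ∷ ys))) ⟩
    p ⊗ h x xs ⊝ altSum (λ y ys → c x ⊗ (c y ⊗ prod c ys ⊗ h y (x ∷ ys))) xs
      ≡⟨ cong (p ⊗ h x xs ⊝_) (altSum-* (c x) _ xs) ⟩
    p ⊗ h x xs ⊝ c x ⊗ altSum (λ y ys → c y ⊗ prod c ys ⊗ h y (x ∷ ys)) xs
      ≡⟨ cong (λ s → p ⊗ h x xs ⊝ c x ⊗ s) (altSum-prod c (λ y ys → h y (x ∷ ys)) xs) ⟩
    p ⊗ h x xs ⊝ c x ⊗ (prod c xs ⊗ altSum (λ y ys → h y (x ∷ ys)) xs)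
      ≡⟨ solve 4 (λ a q h s → a :* q :* h :- a :* (q :* s) := a :* q :* (h :- s)) refl
           (c x) (prod c xs) (h x xs) _ ⟩
    p ⊗ altSum h (x ∷ xs) ∎
    where
    p = c x ⊗ prod c xs

  -- Removing two points in either order leaves the same list, but removing the earlier one first
  -- lowers the index of the later one by 1, which costs a sign.
  altSum-swap : ∀ g xs → altSum (λ y ys → altSum (g y) ys) xs
                       ≡ ⊖ altSum (λ y ys → altSum (λ z → g z y) ys) xs
  altSum-swap g [] = solve 0 (:0 := :- :0) refl
  altSum-swap g (x ∷ xs) = begin
    altSum (g x) xs ⊝ altSum (λ y ys → g y x ys ⊝ altSum (g′ y) ys) xs
      ≡⟨ cong (altSum (g x) xs ⊝_) (split (λ y → g y x) (λ y ys → altSum (g′ y) ys)) ⟩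
    altSum (g x) xs ⊝ (altSum (λ y → g y x) xs ⊝ altSum (λ y ys → altSum (g′ y) ys) xs)
      ≡⟨ cong (λ s → altSum (g x) xs ⊝ (altSum (λ y → g y x) xs ⊝ s)) (altSum-swap g′ xs) ⟩
    altSum (g x) xs ⊝ (altSum (λ y → g y x) xs ⊝ ⊖ s)
      ≡⟨ solve 3 (λ p q s → p :- (q :- (:- s)) := :- (q :- (p :- s))) refl _ _ s ⟩
    ⊖ (altSum (λ y → g y x) xs ⊝ (altSum (g x) xs ⊝ s))
      ≡⟨ cong (λ t → ⊖ (altSum (λ y → g y x) xs ⊝ t))
           (split (g x) (λ y ys → altSum (λ z → g′ z y) ys)) ⟨
    ⊖ (altSum (λ y → g y x) xs ⊝ altSum (λ y ys → g x y ys ⊝ altSum (λ z → g′ z y) ys) xs) ∎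
    where
    g′ : C → C → List C → C
    g′ y z zs = g y z (x ∷ zs)
    s = altSum (λ y ys → altSum (λ z → g′ z y) ys) xs
    split : ∀ f h → altSum (λ y ys → f y ys ⊝ h y ys) xs ≡ altSum f xs ⊝ altSum h xs
    split f h = trans
      (altSum-cong xs λ y ys _ →
        solve 2 (λ p q → p :- q := :1 :* p :+ (:- :1) :* q) refl (f y ys) (h y ys))
      (trans (altSum-linear 𝟙 (⊖ 𝟙) f h xs)
        (solve 2 (λ p q → :1 :* p :+ (:- :1) :* q := p :- q) refl _ _))

  -- This is `Δ xs` times the divided difference Σ_k f(x_k) / Π_{j≠k} (x_k - x_j): the alternating
  -- signs and the smaller Vandermonde products clear the denominators.
  lagrange : (C → C) → List C → C
  lagrange f = altSum (λ y ys → f y ⊗ Δ ys)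

  -- The Leibniz rule for divided differences. It comes from y - b = (x - b) - (x - y), where x - y
  -- completes the product over `ys` to the one over `xs`.
  lagrange-linear-factor : ∀ b f x xs → lagrange (λ y → (y ⊝ b) ⊗ f y) (x ∷ xs)
    ≡ (x ⊝ b) ⊗ lagrange f (x ∷ xs) ⊕ prod (x ⊝_) xs ⊗ lagrange f xs
  lagrange-linear-factor b f x xs = begin
    (x ⊝ b) ⊗ f x ⊗ Δ xs ⊝ altSum (λ y ys → (y ⊝ b) ⊗ f y ⊗ (prod (x ⊝_) ys ⊗ Δ ys)) xs
      ≡⟨ cong ((x ⊝ b) ⊗ f x ⊗ Δ xs ⊝_) (trans
           (altSum-cong xs λ y ys _ →
             solve 6 (λ x y b f p d → (y :- b) :* f :* (p :* d)
                       := (x :- b) :* (f :* (p :* d)) :+ (:- :1) :* ((x :- y) :* p :* (f :* d)))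
               refl x y b (f y) (prod (x ⊝_) ys) (Δ ys))
           (altSum-linear (x ⊝ b) (⊖ 𝟙) _ _ xs)) ⟩
    (x ⊝ b) ⊗ f x ⊗ Δ xs
      ⊝ ((x ⊝ b) ⊗ s ⊕ ⊖ 𝟙 ⊗ altSum (λ y ys → (x ⊝ y) ⊗ prod (x ⊝_) ys ⊗ (f y ⊗ Δ ys)) xs)
      ≡⟨ cong (λ t → (x ⊝ b) ⊗ f x ⊗ Δ xs ⊝ ((x ⊝ b) ⊗ s ⊕ ⊖ 𝟙 ⊗ t))
           (altSum-prod (x ⊝_) (λ y ys → f y ⊗ Δ ys) xs) ⟩
    (x ⊝ b) ⊗ f x ⊗ Δ xs ⊝ ((x ⊝ b) ⊗ s ⊕ ⊖ 𝟙 ⊗ (prod (x ⊝_) xs ⊗ lagrange f xs))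
      ≡⟨ solve 6 (λ c f d s p l → c :* f :* d :- (c :* s :+ (:- :1) :* (p :* l))
                    := c :* (f :* d :- s) :+ p :* l) refl
           (x ⊝ b) (f x) (Δ xs) s (prod (x ⊝_) xs) (lagrange f xs) ⟩
    (x ⊝ b) ⊗ lagrange f (x ∷ xs) ⊕ prod (x ⊝_) xs ⊗ lagrange f xs ∎
    where
    s = altSum (λ y ys → f y ⊗ (prod (x ⊝_) ys ⊗ Δ ys)) xs

  lagrange-root : ∀ b f x xs {t} → lagrange f (x ∷ xs) ≡ 𝟘 → lagrange f xs ≡ t →
                  lagrange (λ y → (y ⊝ b) ⊗ f y) (x ∷ xs) ≡ prod (x ⊝_) xs ⊗ t
  lagrange-root b f x xs {t} e₀ e₁ = trans (lagrange-linear-factor b f x xs) (trans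
    (cong₂ (λ s t → (x ⊝ b) ⊗ s ⊕ prod (x ⊝_) xs ⊗ t) e₀ e₁)
    (solve 3 (λ a q t → a :* :0 :+ q :* t := q :* t) refl (x ⊝ b) (prod (x ⊝_) xs) t))

  -- Polynomial functions with a bound on the degree and the coefficient in that degree.
  data Poly : (C → C) → ℕ → C → Set where
    zero  : ∀ {f d} → (∀ x → f x ≡ 𝟘) → Poly f d 𝟘
    one   : Poly (λ _ → 𝟙) 0 𝟙
    add   : ∀ {f g d c e} → Poly f d c → Poly g d e → Poly (λ x → f x ⊕ g x) d (c ⊕ e)
    scale : ∀ a {f d c} → Poly f d c → Poly (λ x → a ⊗ f x) d (a ⊗ c)
    lin   : ∀ b {f d c} → Poly f d c → Poly (λ x → (x ⊝ b) ⊗ f x) (suc d) c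

  -- The factor is written `x ⊝ 𝟘` in order to be an instance of `lin`.
  power : ℕ → C → C
  power zero    _ = 𝟙
  power (suc d) x = (x ⊝ 𝟘) ⊗ power d x

  power-poly : ∀ d → Poly (power d) d 𝟙
  power-poly zero    = one
  power-poly (suc d) = lin 𝟘 (power-poly d)

  -- Expand every Vandermonde product once more and swap the two removed points.
  lagrange-one : ∀ k →
    (∀ ys → length ys ≡ suc k → lagrange (power k) ys ≡ 𝟙 ⊗ Δ ys) →
    (∀ ys → length ys ≡ suc k → lagrange (λ _ → 𝟙) ys ≡ 𝟘) →
    ∀ xs → length xs ≡ suc (suc k) → lagrange (λ _ → 𝟙) xs ≡ 𝟘
  lagrange-one k expand ih xs e = begin
    altSum (λ y ys → 𝟙 ⊗ Δ ys) xs
      ≡⟨ altSum-cong xs (λ y ys l → sym (expand ys (ℕ.suc-injective (trans l e)))) ⟩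
    altSum (λ y ys → altSum (λ z zs → power k z ⊗ Δ zs) ys) xs
      ≡⟨ altSum-swap (λ y z zs → power k z ⊗ Δ zs) xs ⟩
    ⊖ altSum (λ y ys → altSum (λ z zs → power k y ⊗ Δ zs) ys) xs
      -- After the swap the power depends on the outer point only, and the inner sum is the
      -- vanishing one for the constant function at one point fewer.
      ≡⟨ cong ⊖_ (altSum-zero xs λ y ys l → begin
           altSum (λ z zs → power k y ⊗ Δ zs) ys
             ≡⟨ altSum-* (power k y) (λ _ → Δ) ys ⟩
           power k y ⊗ altSum (λ _ → Δ) ys
             ≡⟨ cong (power k y ⊗_) (altSum-cong ys λ _ zs _ →
                  solve 1 (λ d → d := :1 :* d) refl (Δ zs)) ⟩
           power k y ⊗ lagrange (λ _ → 𝟙) ys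
             ≡⟨ cong (power k y ⊗_) (ih ys (ℕ.suc-injective (trans l e))) ⟩
           power k y ⊗ 𝟘
             ≡⟨ solve 1 (λ p → p :* :0 := :0) refl (power k y) ⟩
           𝟘 ∎) ⟩
    ⊖ 𝟘
      ≡⟨ solve 0 (:- :0 := :0) refl ⟩
    𝟘 ∎

  -- A divided difference of order k picks out the coefficient of degree k. The claims for d = k and
  -- d < k depend on each other: `lin` reduces each to both, and the constant function calls for the
  -- claim about `power` at one point fewer. The recursion is on k first and then on the derivation
  -- of `Poly`.
  lagrange-poly : ∀ k {f d c} → Poly f d c → ∀ xs → length xs ≡ suc k →
                  (d ≡ k → lagrange f xs ≡ c ⊗ Δ xs) × (d < k → lagrange f xs ≡ 𝟘)
  lagrange-poly k {f} (zero f≗0) xs e =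
    (λ _ → trans vanish (solve 1 (λ d → :0 := :0 :* d) refl (Δ xs))) , (λ _ → vanish)
    where
    vanish : lagrange f xs ≡ 𝟘
    vanish = altSum-zero xs λ y ys _ →
      trans (cong (_⊗ Δ ys) (f≗0 y)) (solve 1 (λ d → :0 :* d := :0) refl (Δ ys))
  lagrange-poly zero one (x ∷ []) refl =
    (λ _ → solve 0 (:1 :* :1 :- :0 := :1 :* (:1 :* :1)) refl) , (λ ())
  lagrange-poly (suc zero) one (x ∷ y ∷ []) refl =
    (λ ()) , (λ _ → solve 0 (:1 :* (:1 :* :1) :- (:1 :* (:1 :* :1) :- :0) := :0) refl)
  lagrange-poly (suc (suc k)) one xs e = (λ ()) , (λ _ → lagrange-one (suc k)
    (λ ys l → proj₁ (lagrange-poly (suc k) (power-poly (suc k)) ys l) refl)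
    (λ ys l → proj₂ (lagrange-poly (suc k) one ys l) (s≤s z≤n)) xs e)
  lagrange-poly k (add {f} {g} {c = c} {e = c′} p q) xs e =
    (λ d≡k → trans split (trans (cong₂ _⊕_ (proj₁ p′ d≡k) (proj₁ q′ d≡k))
               (solve 3 (λ a b d → a :* d :+ b :* d := (a :+ b) :* d) refl c c′ (Δ xs))))
    , (λ d<k → trans split (trans (cong₂ _⊕_ (proj₂ p′ d<k) (proj₂ q′ d<k))
                 (solve 0 (:0 :+ :0 := :0) refl)))
    where
    p′ = lagrange-poly k p xs e
    q′ = lagrange-poly k q xs e
    split : lagrange (λ x → f x ⊕ g x) xs ≡ lagrange f xs ⊕ lagrange g xs
    split = trans
      (altSum-cong xs λ y ys _ →
        solve 3 (λ a b d → (a :+ b) :* d := a :* d :+ b :* d) refl (f y) (g y) (Δ ys))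
      (altSum-+ _ _ xs)
  lagrange-poly k (scale a {f} {c = c} p) xs e =
    (λ d≡k → trans split (trans (cong (a ⊗_) (proj₁ p′ d≡k))
               (solve 3 (λ a c d → a :* (c :* d) := a :* c :* d) refl a c (Δ xs))))
    , (λ d<k → trans split (trans (cong (a ⊗_) (proj₂ p′ d<k))
                 (solve 1 (λ a → a :* :0 := :0) refl a)))
    where
    p′ = lagrange-poly k p xs e
    split : lagrange (λ x → a ⊗ f x) xs ≡ a ⊗ lagrange f xs
    split = trans
      (altSum-cong xs λ y ys _ →
        solve 3 (λ a b d → a :* b :* d := a :* (b :* d)) refl a (f y) (Δ ys))
      (altSum-* a _ xs)
  lagrange-poly zero (lin b p) xs e = (λ ()) , (λ ())
  lagrange-poly (suc k) (lin b {f} {c = c} p) (x ∷ xs) e =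
      (λ d≡k → trans
        (lagrange-root b f x xs
          (proj₂ (lagrange-poly (suc k) p (x ∷ xs) e) (ℕ.≤-reflexive d≡k))
          (proj₁ (lagrange-poly k p xs (ℕ.suc-injective e)) (ℕ.suc-injective d≡k)))
        (solve 3 (λ q c d → q :* (c :* d) := c :* (q :* d)) refl (prod (x ⊝_) xs) c (Δ xs)))
    , (λ d<k → trans
        (lagrange-root b f x xs
          (proj₂ (lagrange-poly (suc k) p (x ∷ xs) e) (ℕ.m<n⇒m<1+n (s≤s⁻¹ d<k)))
          (proj₂ (lagrange-poly k p xs (ℕ.suc-injective e)) (s≤s⁻¹ d<k)))
        (solve 1 (λ q → q :* :0 := :0) refl (prod (x ⊝_) xs)))

  lagrange-lead : ∀ {f d c} → Poly f d c → ∀ xs → length xs ≡ suc d → lagrange f xs ≡ c ⊗ Δ xs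
  lagrange-lead {d = d} p xs e = proj₁ (lagrange-poly d p xs e) refl

-- Exact integration in square-zero variables

module Integral (R : ℤ-Algebra) (z : ℕ → ℤ-Algebra.Carrier R)
                (z²≡0 : ∀ t → ℤ-Algebra._⊗_ R (z t) (z t) ≡ ℤ-Algebra.𝟘 R) where
  open ℤ-Algebra R renaming (Carrier to C)
  open Solver R
  open Vandermonde R

  below : ℕ → (ℕ → C) → C
  below zero    g = 𝟘
  below (suc b) g = g 0 ⊕ below b (λ t → g (suc t))

  below-cong : ∀ b {g h} → (∀ t → g t ≡ h t) → below b g ≡ below b h
  below-cong zero    e = refl
  below-cong (suc b) e = cong₂ _⊕_ (e 0) (below-cong b (λ t → e (suc t)))

  below-+ : ∀ b g h → below b (λ t → g t ⊕ h t) ≡ below b g ⊕ below b h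
  below-+ zero    g h = solve 0 (:0 := :0 :+ :0) refl
  below-+ (suc b) g h = trans (cong (g 0 ⊕ h 0 ⊕_) (below-+ b _ _))
    (solve 4 (λ a b c d → a :+ b :+ (c :+ d) := a :+ c :+ (b :+ d)) refl _ _ _ _)

  below-* : ∀ b c g → below b (λ t → c ⊗ g t) ≡ c ⊗ below b g
  below-* zero    c g = solve 1 (λ c → :0 := c :* :0) refl c
  below-* (suc b) c g = trans (cong (c ⊗ g 0 ⊕_) (below-* b c _))
    (solve 3 (λ c a b → c :* a :+ c :* b := c :* (a :+ b)) refl _ _ _)

  X : ℕ → C
  X t = below t z

  -- A difference of two sums from 0, hence meaningful for any two ends; for a ≤ b it is the sum
  -- over a ≤ t < b, with `z t` as the measure of the step at t.
  ∫ : ℕ → ℕ → (C → C) → C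
  ∫ a b f = below b (λ t → z t ⊗ f (X t)) ⊝ below a (λ t → z t ⊗ f (X t))

  ∫-cong : ∀ a b {f g} → (∀ x → f x ≡ g x) → ∫ a b f ≡ ∫ a b g
  ∫-cong a b e = cong₂ _⊝_ (below-cong b λ t → cong (z t ⊗_) (e (X t)))
                           (below-cong a λ t → cong (z t ⊗_) (e (X t)))

  ∫-+ : ∀ a b f g → ∫ a b (λ x → f x ⊕ g x) ≡ ∫ a b f ⊕ ∫ a b g
  ∫-+ a b f g = trans (cong₂ _⊝_ (split b) (split a))
    (solve 4 (λ p q r s → p :+ q :- (r :+ s) := p :- r :+ (q :- s)) refl _ _ _ _)
    where
    split : ∀ b → below b (λ t → z t ⊗ (f (X t) ⊕ g (X t)))
                ≡ below b (λ t → z t ⊗ f (X t)) ⊕ below b (λ t → z t ⊗ g (X t))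
    split b = trans
      (below-cong b λ t → solve 3 (λ p q r → p :* (q :+ r) := p :* q :+ p :* r) refl _ _ _)
      (below-+ b _ _)

  ∫-* : ∀ a b c f → ∫ a b (λ x → c ⊗ f x) ≡ c ⊗ ∫ a b f
  ∫-* a b c f = trans (cong₂ _⊝_ (split b) (split a))
    (solve 3 (λ c p q → c :* p :- c :* q := c :* (p :- q)) refl _ _ _)
    where
    split : ∀ b → below b (λ t → z t ⊗ (c ⊗ f (X t))) ≡ c ⊗ below b (λ t → z t ⊗ f (X t))
    split b = trans
      (below-cong b λ t → solve 3 (λ p q r → p :* (q :* r) := q :* (p :* r)) refl _ _ _)
      (below-* b c _)

  -- The dual-number notion of derivative: a first-order expansion without remainder. Integration
  -- applies it to increments ε = `z t`.
  IsDerivative : (C → C) → (C → C) → Set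
  IsDerivative F F′ = ∀ x ε → ε ⊗ ε ≡ 𝟘 → F (x ⊕ ε) ≡ F x ⊕ ε ⊗ F′ x

  -- Exact because every increment z t squares to 0.
  ∫-derivative : ∀ {F F′} → IsDerivative F F′ → ∀ a b → ∫ a b F′ ≡ F (X b) ⊝ F (X a)
  ∫-derivative {F} {F′} der a b = trans (cong₂ _⊝_ (from0 b) (from0 a))
    (solve 3 (λ p q r → p :- r :- (q :- r) := p :- q) refl (F (X b)) (F (X a)) (F 𝟘))
    where
    -- The starting point and the sequence of increments both vary, because the induction moves the
    -- first increment into the starting point.
    telescope : ∀ b z → (∀ t → z t ⊗ z t ≡ 𝟘) → ∀ x →
      below b (λ t → z t ⊗ F′ (x ⊕ below t z)) ≡ F (x ⊕ below b z) ⊝ F x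
    telescope zero z z² x = trans
      (solve 1 (λ a → :0 := a :- a) refl (F x))
      (cong (λ y → F y ⊝ F x) (solve 1 (λ x → x := x :+ :0) refl x))
    telescope (suc b) z z² x = begin
      z 0 ⊗ F′ (x ⊕ 𝟘) ⊕ below b (λ t → z (suc t) ⊗ F′ (x ⊕ (z 0 ⊕ below t z′)))
        ≡⟨ cong₂ _⊕_ (cong (λ y → z 0 ⊗ F′ y) (solve 1 (λ x → x :+ :0 := x) refl x))
             (below-cong b λ t → cong (λ y → z (suc t) ⊗ F′ y) (reassoc (below t z′))) ⟩
      z 0 ⊗ F′ x ⊕ below b (λ t → z (suc t) ⊗ F′ (x ⊕ z 0 ⊕ below t z′))
        ≡⟨ cong (z 0 ⊗ F′ x ⊕_) (telescope b z′ (λ t → z² (suc t)) (x ⊕ z 0)) ⟩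
      z 0 ⊗ F′ x ⊕ (F (x ⊕ z 0 ⊕ below b z′) ⊝ F (x ⊕ z 0))
        ≡⟨ cong (λ y → z 0 ⊗ F′ x ⊕ (F (x ⊕ z 0 ⊕ below b z′) ⊝ y)) (der x (z 0) (z² 0)) ⟩
      z 0 ⊗ F′ x ⊕ (F (x ⊕ z 0 ⊕ below b z′) ⊝ (F x ⊕ z 0 ⊗ F′ x))
        ≡⟨ solve 3 (λ d p q → d :+ (p :- (q :+ d)) := p :- q) refl _ _ _ ⟩
      F (x ⊕ z 0 ⊕ below b z′) ⊝ F x
        ≡⟨ cong (λ y → F y ⊝ F x) (reassoc (below b z′)) ⟨
      F (x ⊕ (z 0 ⊕ below b z′)) ⊝ F x ∎
      where
      z′ : ℕ → C
      z′ t = z (suc t)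
      reassoc : ∀ y → x ⊕ (z 0 ⊕ y) ≡ x ⊕ z 0 ⊕ y
      reassoc y = solve 3 (λ a b c → a :+ (b :+ c) := a :+ b :+ c) refl x (z 0) y

    shift : ∀ y → y ≡ 𝟘 ⊕ y
    shift y = solve 1 (λ y → y := :0 :+ y) refl y

    from0 : ∀ b → below b (λ t → z t ⊗ F′ (X t)) ≡ F (X b) ⊝ F 𝟘
    from0 b = begin
      below b (λ t → z t ⊗ F′ (X t))       ≡⟨ below-cong b (λ t → cong (λ y → z t ⊗ F′ y) (shift (X t))) ⟩
      below b (λ t → z t ⊗ F′ (𝟘 ⊕ X t))   ≡⟨ telescope b z z²≡0 𝟘 ⟩
      F (𝟘 ⊕ X b) ⊝ F 𝟘                    ≡⟨ cong (λ y → F y ⊝ F 𝟘) (shift (X b)) ⟨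
      F (X b) ⊝ F 𝟘                        ∎

  ∫∫ : List (ℕ × ℕ) → (List C → C) → C
  ∫∫ []             F = F []
  ∫∫ ((a , b) ∷ is) F = ∫ a b (λ x → ∫∫ is (λ xs → F (x ∷ xs)))

  ∫∫-cong : ∀ is {F G} → (∀ xs → length xs ≡ length is → F xs ≡ G xs) → ∫∫ is F ≡ ∫∫ is G
  ∫∫-cong []             e = e [] refl
  ∫∫-cong ((a , b) ∷ is) e = ∫-cong a b λ x → ∫∫-cong is λ xs l → e (x ∷ xs) (cong suc l)

  ∫∫-+ : ∀ is F G → ∫∫ is (λ xs → F xs ⊕ G xs) ≡ ∫∫ is F ⊕ ∫∫ is G
  ∫∫-+ []             F G = refl
  ∫∫-+ ((a , b) ∷ is) F G = trans
    (∫-cong a b λ x → ∫∫-+ is (λ xs → F (x ∷ xs)) (λ xs → G (x ∷ xs)))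
    (∫-+ a b (λ x → ∫∫ is (λ xs → F (x ∷ xs))) (λ x → ∫∫ is (λ xs → G (x ∷ xs))))

  ∫∫-* : ∀ is c F → ∫∫ is (λ xs → c ⊗ F xs) ≡ c ⊗ ∫∫ is F
  ∫∫-* []             c F = refl
  ∫∫-* ((a , b) ∷ is) c F = trans
    (∫-cong a b λ x → ∫∫-* is c (λ xs → F (x ∷ xs)))
    (∫-* a b c (λ x → ∫∫ is (λ xs → F (x ∷ xs))))

  -- In each summand one variable occurs only in the factor h.
  ∫∫-altSum : ∀ h is → All (λ (a , b) → ∫ a b h ≡ 𝟘) is → ∀ G →
              ∫∫ is (altSum (λ y ys → h y ⊗ G ys)) ≡ 𝟘
  ∫∫-altSum h []             []           G = refl
  ∫∫-altSum h ((a , b) ∷ is) (∫h≡0 ∷ all) G = begin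
    ∫ a b (λ x → ∫∫ is (λ xs → h x ⊗ G xs ⊝ altSum (λ y ys → h y ⊗ G (x ∷ ys)) xs))
      ≡⟨ ∫-cong a b (λ x → begin
           ∫∫ is (λ xs → h x ⊗ G xs ⊝ altSum (λ y ys → h y ⊗ G (x ∷ ys)) xs)
             ≡⟨ ∫∫-cong is (λ xs _ → solve 2 (λ p q → p :- q := p :+ (:- :1) :* q) refl _ _) ⟩
           ∫∫ is (λ xs → h x ⊗ G xs ⊕ ⊖ 𝟙 ⊗ altSum (λ y ys → h y ⊗ G (x ∷ ys)) xs)
             ≡⟨ ∫∫-+ is _ _ ⟩
           ∫∫ is (λ xs → h x ⊗ G xs) ⊕ ∫∫ is (λ xs → ⊖ 𝟙 ⊗ altSum (λ y ys → h y ⊗ G (x ∷ ys)) xs)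
             ≡⟨ cong₂ _⊕_ (∫∫-* is (h x) G)
                  (trans (∫∫-* is (⊖ 𝟙) _) (cong (⊖ 𝟙 ⊗_) (∫∫-altSum h is all (λ ys → G (x ∷ ys))))) ⟩
           h x ⊗ ∫∫ is G ⊕ ⊖ 𝟙 ⊗ 𝟘
             ≡⟨ solve 2 (λ p q → p :* q :+ (:- :1) :* :0 := q :* p) refl _ _ ⟩
           ∫∫ is G ⊗ h x ∎) ⟩
    ∫ a b (λ x → ∫∫ is G ⊗ h x)  ≡⟨ ∫-* a b (∫∫ is G) h ⟩
    ∫∫ is G ⊗ ∫ a b h            ≡⟨ cong (∫∫ is G ⊗_) ∫h≡0 ⟩
    ∫∫ is G ⊗ 𝟘                  ≡⟨ solve 1 (λ p → p :* :0 := :0) refl _ ⟩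
    𝟘                            ∎

  prod-⊗ : {A : Set} (f g : A → C) → ∀ xs → prod (λ x → f x ⊗ g x) xs ≡ prod f xs ⊗ prod g xs
  prod-⊗ f g []       = solve 0 (:1 := :1 :* :1) refl
  prod-⊗ f g (x ∷ xs) = trans (cong (f x ⊗ g x ⊗_) (prod-⊗ f g xs))
    (solve 4 (λ a b c d → a :* b :* (c :* d) := a :* c :* (b :* d)) refl _ _ _ _)

  -- The factors `c ⊝ x` are those by which `Δ (c ∷ xs)` exceeds `Δ xs`; interpolation at c and the
  -- variables trades them for the constants S and `Q c`.
  raise-weight : ∀ W Q {S} is → Poly Q (length is) S →
    All (λ (a , b) → ∫ a b (λ x → W x ⊗ Q x) ≡ 𝟘) is → ∀ c →
    S ⊗ ∫∫ is (λ xs → prod (λ x → (c ⊝ x) ⊗ W x) xs ⊗ Δ xs) ≡ Q c ⊗ ∫∫ is (λ xs → prod W xs ⊗ Δ xs)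
  raise-weight W Q {S} is poly all c = begin
    S ⊗ ∫∫ is (λ xs → prod (λ x → (c ⊝ x) ⊗ W x) xs ⊗ Δ xs)
      ≡⟨ ∫∫-* is S _ ⟨
    ∫∫ is (λ xs → S ⊗ (prod (λ x → (c ⊝ x) ⊗ W x) xs ⊗ Δ xs))
      ≡⟨ ∫∫-cong is expand ⟩
    ∫∫ is (λ xs → Q c ⊗ (prod W xs ⊗ Δ xs)
                ⊕ ⊖ 𝟙 ⊗ altSum (λ y ys → W y ⊗ Q y ⊗ (prod W ys ⊗ Δ (c ∷ ys))) xs)
      ≡⟨ ∫∫-+ is _ _ ⟩
    ∫∫ is (λ xs → Q c ⊗ (prod W xs ⊗ Δ xs))
      ⊕ ∫∫ is (λ xs → ⊖ 𝟙 ⊗ altSum (λ y ys → W y ⊗ Q y ⊗ (prod W ys ⊗ Δ (c ∷ ys))) xs)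
      ≡⟨ cong₂ _⊕_ (∫∫-* is (Q c) _) (trans (∫∫-* is (⊖ 𝟙) _)
           (cong (⊖ 𝟙 ⊗_) (∫∫-altSum (λ x → W x ⊗ Q x) is all (λ ys → prod W ys ⊗ Δ (c ∷ ys))))) ⟩
    Q c ⊗ ∫∫ is (λ xs → prod W xs ⊗ Δ xs) ⊕ ⊖ 𝟙 ⊗ 𝟘
      ≡⟨ solve 1 (λ p → p :+ (:- :1) :* :0 := p) refl _ ⟩
    Q c ⊗ ∫∫ is (λ xs → prod W xs ⊗ Δ xs) ∎
    where
    expand : ∀ xs → length xs ≡ length is →
      S ⊗ (prod (λ x → (c ⊝ x) ⊗ W x) xs ⊗ Δ xs)
        ≡ Q c ⊗ (prod W xs ⊗ Δ xs) ⊕ ⊖ 𝟙 ⊗ altSum (λ y ys → W y ⊗ Q y ⊗ (prod W ys ⊗ Δ (c ∷ ys))) xs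
    expand xs l = begin
      S ⊗ (prod (λ x → (c ⊝ x) ⊗ W x) xs ⊗ Δ xs)
        ≡⟨ cong (λ p → S ⊗ (p ⊗ Δ xs)) (prod-⊗ (c ⊝_) W xs) ⟩
      S ⊗ (prod (c ⊝_) xs ⊗ prod W xs ⊗ Δ xs)
        ≡⟨ solve 4 (λ s p w d → s :* (p :* w :* d) := w :* (s :* (p :* d))) refl _ _ _ _ ⟩
      prod W xs ⊗ (S ⊗ Δ (c ∷ xs))
        ≡⟨ cong (prod W xs ⊗_) (lagrange-lead poly (c ∷ xs) (cong suc l)) ⟨
      prod W xs ⊗ (Q c ⊗ Δ xs ⊝ altSum (λ y ys → Q y ⊗ Δ (c ∷ ys)) xs)
        ≡⟨ solve 4 (λ w q d s → w :* (q :* d :- s) := q :* (w :* d) :+ (:- :1) :* (w :* s)) refl _ _ _ _ ⟩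
      Q c ⊗ (prod W xs ⊗ Δ xs) ⊕ ⊖ 𝟙 ⊗ (prod W xs ⊗ altSum (λ y ys → Q y ⊗ Δ (c ∷ ys)) xs)
        -- `altSum-prod` carries the product of all weights into the sum, which gives the removed
        -- point y the factor `W y ⊗ Q y` whose integrals vanish.
        ≡⟨ cong (λ s → Q c ⊗ (prod W xs ⊗ Δ xs) ⊕ ⊖ 𝟙 ⊗ s) (trans
             (sym (altSum-prod W _ xs))
             (altSum-cong xs λ y ys _ →
               solve 4 (λ w p q d → w :* p :* (q :* d) := w :* q :* (p :* d)) refl _ _ _ _)) ⟩
      Q c ⊗ (prod W xs ⊗ Δ xs) ⊕ ⊖ 𝟙 ⊗ altSum (λ y ys → W y ⊗ Q y ⊗ (prod W ys ⊗ Δ (c ∷ ys))) xs ∎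

  -- Without a weight the point c can itself be the first integration variable: the surviving term
  -- `Q x ⊗ Δ xs` separates, so the integral becomes a product.
  drop-first-variable : ∀ Q {S} a b is → Poly Q (length is) S →
    All (λ (a , b) → ∫ a b Q ≡ 𝟘) is →
    S ⊗ ∫∫ ((a , b) ∷ is) Δ ≡ ∫ a b Q ⊗ ∫∫ is Δ
  drop-first-variable Q {S} a b is poly all = begin
    S ⊗ ∫∫ ((a , b) ∷ is) Δ
      ≡⟨ ∫-* a b S (λ x → ∫∫ is (λ xs → Δ (x ∷ xs))) ⟨
    ∫ a b (λ x → S ⊗ ∫∫ is (λ xs → Δ (x ∷ xs)))
      ≡⟨ ∫-cong a b (λ x → begin
           S ⊗ ∫∫ is (λ xs → Δ (x ∷ xs))
             ≡⟨ ∫∫-* is S _ ⟨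
           ∫∫ is (λ xs → S ⊗ Δ (x ∷ xs))
             ≡⟨ ∫∫-cong is (λ xs l → trans
                  (sym (lagrange-lead poly (x ∷ xs) (cong suc l)))
                  (solve 2 (λ p q → p :- q := p :+ (:- :1) :* q) refl _ _)) ⟩
           ∫∫ is (λ xs → Q x ⊗ Δ xs ⊕ ⊖ 𝟙 ⊗ altSum (λ y ys → Q y ⊗ Δ (x ∷ ys)) xs)
             ≡⟨ ∫∫-+ is _ _ ⟩
           ∫∫ is (λ xs → Q x ⊗ Δ xs) ⊕ ∫∫ is (λ xs → ⊖ 𝟙 ⊗ altSum (λ y ys → Q y ⊗ Δ (x ∷ ys)) xs)
             ≡⟨ cong₂ _⊕_ (∫∫-* is (Q x) Δ) (trans (∫∫-* is (⊖ 𝟙) _)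
                  (cong (⊖ 𝟙 ⊗_) (∫∫-altSum Q is all (λ ys → Δ (x ∷ ys))))) ⟩
           Q x ⊗ ∫∫ is Δ ⊕ ⊖ 𝟙 ⊗ 𝟘
             ≡⟨ solve 2 (λ p q → p :* q :+ (:- :1) :* :0 := q :* p) refl _ _ ⟩
           ∫∫ is Δ ⊗ Q x ∎) ⟩
    ∫ a b (λ x → ∫∫ is Δ ⊗ Q x)   ≡⟨ ∫-* a b (∫∫ is Δ) Q ⟩
    ∫∫ is Δ ⊗ ∫ a b Q             ≡⟨ solve 2 (λ p q → p :* q := q :* p) refl _ _ ⟩
    ∫ a b Q ⊗ ∫∫ is Δ             ∎

-- Equality up to sign

module UpToSign (R : ℤ-Algebra) where
  open ℤ-Algebra R renaming (Carrier to C)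
  open Solver R

  infix 4 _~_
  -- Compatible with products but not with sums: a sign under a sum is first extracted as an
  -- explicit factor, as in `flip-prod` and `weaveSign`.
  _~_ : C → C → Set
  x ~ y = x ≡ y ⊎ x ≡ ⊖ y

  ~-trans : ∀ {x y c} → x ~ y → y ~ c → x ~ c
  ~-trans (inj₁ refl) q           = q
  ~-trans (inj₂ p)    (inj₁ refl) = inj₂ p
  ~-trans {c = c} (inj₂ p) (inj₂ refl) = inj₁ (trans p (solve 1 (λ c → :- (:- c) := c) refl c))

  ~-sym : ∀ {x y} → x ~ y → y ~ x
  ~-sym (inj₁ p) = inj₁ (sym p)
  ~-sym {y = y} (inj₂ refl) = inj₂ (solve 1 (λ y → y := :- (:- y)) refl y)

  ~-⊗ : ∀ {x y c d} → x ~ y → c ~ d → x ⊗ c ~ y ⊗ d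
  ~-⊗ (inj₁ refl) (inj₁ refl) = inj₁ refl
  ~-⊗ {x} {d = d} (inj₁ refl) (inj₂ refl) = inj₂ (solve 2 (λ x d → x :* (:- d) := :- (x :* d)) refl x d)
  ~-⊗ {y = y} {c} (inj₂ refl) (inj₁ refl) = inj₂ (solve 2 (λ y c → (:- y) :* c := :- (y :* c)) refl y c)
  ~-⊗ {y = y} {d = d} (inj₂ refl) (inj₂ refl) = inj₁ (solve 2 (λ y d → (:- y) :* (:- d) := y :* d) refl y d)

  infixr 8 _^^_
  _^^_ : C → ℕ → C
  x ^^ zero  = 𝟙
  x ^^ suc n = x ⊗ x ^^ n

  -1^_ : ℕ → C
  -1^ n = (⊖ 𝟙) ^^ n

  -1^n~1 : ∀ n → -1^ n ~ 𝟙
  -1^n~1 zero    = inj₁ refl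
  -1^n~1 (suc n) = ~-trans (~-⊗ (inj₂ {A = ⊖ 𝟙 ≡ 𝟙} refl) (-1^n~1 n)) (inj₁ (solve 0 (:1 :* :1 := :1) refl))

  ^^-+ : ∀ x m n → x ^^ (m + n) ≡ x ^^ m ⊗ x ^^ n
  ^^-+ x zero    n = solve 1 (λ a → a := :1 :* a) refl _
  ^^-+ x (suc m) n = trans (cong (x ⊗_) (^^-+ x m n))
    (solve 3 (λ a b c → a :* (b :* c) := a :* b :* c) refl _ _ _)

  ⊝-swap-^^ : ∀ x y n → (x ⊝ y) ^^ n ≡ -1^ n ⊗ (y ⊝ x) ^^ n
  ⊝-swap-^^ x y zero    = solve 0 (:1 := :1 :* :1) refl
  ⊝-swap-^^ x y (suc n) = trans (cong ((x ⊝ y) ⊗_) (⊝-swap-^^ x y n))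
    (solve 4 (λ x y s p → (x :- y) :* (s :* p) := (:- :1) :* s :* ((y :- x) :* p)) refl x y _ _)

  fromℕ : ℕ → C
  fromℕ n = ι (ℤ.+ n)

  fromℕ-+ : ∀ m n → fromℕ (m + n) ≡ fromℕ m ⊕ fromℕ n
  fromℕ-+ m n = ι-+ (ℤ.+ m) (ℤ.+ n)

  fromℕ-* : ∀ m n → fromℕ (m * n) ≡ fromℕ m ⊗ fromℕ n
  fromℕ-* m n = trans (cong ι (ℤ.pos-* m n)) (ι-* (ℤ.+ m) (ℤ.+ n))

-- The Dixon-Anderson evaluation

module DixonAnderson (R : ℤ-Algebra) (z : ℕ → ℤ-Algebra.Carrier R)
                     (z²≡0 : ∀ t → ℤ-Algebra._⊗_ R (z t) (z t) ≡ ℤ-Algebra.𝟘 R) where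
  open ℤ-Algebra R renaming (Carrier to C)
  open Solver R
  open Vandermonde R
  open Integral R z z²≡0
  open UpToSign R

  prod-cong : {A : Set} {f g : A → C} → (∀ x → f x ≡ g x) → ∀ xs → prod f xs ≡ prod g xs
  prod-cong e []       = refl
  prod-cong e (x ∷ xs) = cong₂ _⊗_ (e x) (prod-cong e xs)

  prod-one : {A : Set} {f : A → C} → (∀ x → f x ≡ 𝟙) → ∀ xs → prod f xs ≡ 𝟙
  prod-one e []       = refl
  prod-one e (x ∷ xs) = trans (cong₂ _⊗_ (e x) (prod-one e xs)) (solve 0 (:1 :* :1 := :1) refl)

  prod-++ : {A : Set} (f : A → C) → ∀ xs ys → prod f (xs ++ ys) ≡ prod f xs ⊗ prod f ys
  prod-++ f []       ys = solve 1 (λ a → a := :1 :* a) refl _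
  prod-++ f (x ∷ xs) ys = trans (cong (f x ⊗_) (prod-++ f xs ys))
    (solve 3 (λ a b c → a :* (b :* c) := a :* b :* c) refl _ _ _)

  -- A node (p , α) is the point X p with exponent α.
  Node : Set
  Node = ℕ × ℕ

  nodal : List Node → C → C
  nodal ps x = prod (λ (p , _) → x ⊝ X p) ps

  weight : List Node → C → C
  weight ps x = prod (λ (p , α) → (x ⊝ X p) ^^ α) ps

  -- weight ⊗ cofactor is the derivative of weight ⊗ nodal.
  cofactor : List Node → C → C
  cofactor []             x = 𝟘
  cofactor ((p , α) ∷ ps) x = fromℕ (suc α) ⊗ nodal ps x ⊕ (x ⊝ X p) ⊗ cofactor ps x

  -- The degree of `weight ⊗ nodal`, and therefore the leading coefficient S of the cofactor.
  order : List Node → ℕ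
  order []             = 0
  order ((p , α) ∷ ps) = suc α + order ps

  nodal-poly : ∀ ps → Poly (nodal ps) (length ps) 𝟙
  nodal-poly []       = one
  nodal-poly ((p , α) ∷ ps) = lin (X p) (nodal-poly ps)

  -- Differentiation lowers the degree by one, so the degree is one below the number of nodes;
  -- splitting the list as `q ∷ ps` expresses this without subtraction.
  cofactor-poly : ∀ q ps → Poly (cofactor (q ∷ ps)) (length ps) (fromℕ (order (q ∷ ps)))
  cofactor-poly (p , α) [] = subst (Poly _ 0) eq
    (add (scale (fromℕ (suc α)) one) (zero λ x → solve 1 (λ t → t :* :0 := :0) refl (x ⊝ X p)))
    where
    eq : fromℕ (suc α) ⊗ 𝟙 ⊕ 𝟘 ≡ fromℕ (suc α + 0)
    eq = trans (solve 1 (λ a → a :* :1 :+ :0 := a) refl _) (cong fromℕ (sym (ℕ.+-identityʳ (suc α))))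
  cofactor-poly (p , α) (q ∷ ps) = subst (Poly _ _) eq
    (add (scale (fromℕ (suc α)) (nodal-poly (q ∷ ps))) (lin (X p) (cofactor-poly q ps)))
    where
    eq : fromℕ (suc α) ⊗ 𝟙 ⊕ fromℕ (order (q ∷ ps)) ≡ fromℕ (suc α + order (q ∷ ps))
    eq = trans (solve 2 (λ a b → a :* :1 :+ b := a :+ b) refl _ _) (sym (fromℕ-+ (suc α) _))

  derivative-⊗ : ∀ {F F′ G G′} → IsDerivative F F′ → IsDerivative G G′ →
                 IsDerivative (λ x → F x ⊗ G x) (λ x → F′ x ⊗ G x ⊕ F x ⊗ G′ x)
  derivative-⊗ {F} {F′} {G} {G′} dF dG x ε ε² = begin
    F (x ⊕ ε) ⊗ G (x ⊕ ε)
      ≡⟨ cong₂ _⊗_ (dF x ε ε²) (dG x ε ε²) ⟩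
    (F x ⊕ ε ⊗ F′ x) ⊗ (G x ⊕ ε ⊗ G′ x)
      ≡⟨ solve 5 (λ f f′ g g′ e → (f :+ e :* f′) :* (g :+ e :* g′)
           := f :* g :+ e :* (f′ :* g :+ f :* g′) :+ e :* e :* (f′ :* g′)) refl _ _ _ _ ε ⟩
    F x ⊗ G x ⊕ ε ⊗ (F′ x ⊗ G x ⊕ F x ⊗ G′ x) ⊕ ε ⊗ ε ⊗ (F′ x ⊗ G′ x)
      ≡⟨ cong (λ e → F x ⊗ G x ⊕ ε ⊗ (F′ x ⊗ G x ⊕ F x ⊗ G′ x) ⊕ e ⊗ (F′ x ⊗ G′ x)) ε² ⟩
    F x ⊗ G x ⊕ ε ⊗ (F′ x ⊗ G x ⊕ F x ⊗ G′ x) ⊕ 𝟘 ⊗ (F′ x ⊗ G′ x)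
      ≡⟨ solve 2 (λ a b → a :+ :0 :* b := a) refl _ _ ⟩
    F x ⊗ G x ⊕ ε ⊗ (F′ x ⊗ G x ⊕ F x ⊗ G′ x) ∎

  derivative-cong : ∀ {F F′ G G′} → (∀ x → F x ≡ G x) → (∀ x → F′ x ≡ G′ x) →
                    IsDerivative F F′ → IsDerivative G G′
  derivative-cong e e′ d x ε ε² = trans (sym (e (x ⊕ ε)))
    (trans (d x ε ε²) (cong₂ (λ a b → a ⊕ ε ⊗ b) (e x) (e′ x)))

  -- The last factor is kept apart: the power comes from `weight` and the extra factor from `nodal`,
  -- and no exponent n - 1 appears.
  derivative-power : ∀ c n → IsDerivative (λ x → (x ⊝ c) ^^ n ⊗ (x ⊝ c)) (λ x → fromℕ (suc n) ⊗ (x ⊝ c) ^^ n)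
  derivative-power c zero x ε ε² =
    solve 3 (λ x c e → :1 :* (x :+ e :- c) := :1 :* (x :- c) :+ e :* (:1 :* :1)) refl x c ε
  derivative-power c (suc n) = derivative-cong
    (λ x → solve 2 (λ t p → t :* (p :* t) := t :* p :* t) refl (x ⊝ c) _)
    (λ x → trans (solve 3 (λ t p k → :1 :* (p :* t) :+ t :* (k :* p) := (:1 :+ k) :* (t :* p))
                   refl (x ⊝ c) ((x ⊝ c) ^^ n) (fromℕ (suc n)))
                 (cong (_⊗ ((x ⊝ c) ⊗ (x ⊝ c) ^^ n)) (sym (fromℕ-+ 1 (suc n)))))
    (derivative-⊗ {F = _⊝ c} {F′ = λ _ → 𝟙}
      (λ x ε _ → solve 3 (λ x c e → x :+ e :- c := x :- c :+ e :* :1) refl x c ε)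
      (derivative-power c n))

  cofactor-derivative : ∀ ps →
    IsDerivative (λ x → weight ps x ⊗ nodal ps x) (λ x → weight ps x ⊗ cofactor ps x)
  cofactor-derivative [] x ε _ = solve 1 (λ e → :1 :* :1 := :1 :* :1 :+ e :* (:1 :* :0)) refl ε
  cofactor-derivative ((p , α) ∷ ps) = derivative-cong
    (λ x → solve 4 (λ a t w n → a :* t :* (w :* n) := a :* w :* (t :* n)) refl _ _ _ _)
    (λ x → solve 6 (λ k a t w n r → k :* a :* (w :* n) :+ a :* t :* (w :* r)
                                 := a :* w :* (k :* n :+ t :* r)) refl
             (fromℕ (suc α)) _ _ _ _ _)
    (derivative-⊗ (derivative-power (X p) α) (cofactor-derivative ps))

  gaps : List Node → List (ℕ × ℕ)
  gaps []                       = []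
  gaps (_ ∷ [])                 = []
  gaps ((p , _) ∷ (q , β) ∷ ps) = (p , q) ∷ gaps ((q , β) ∷ ps)

  length-gaps : ∀ q ps → length (gaps (q ∷ ps)) ≡ length ps
  length-gaps q []       = refl
  length-gaps q (r ∷ ps) = cong suc (length-gaps r ps)

  cofactor-poly-gaps : ∀ q ps →
    Poly (cofactor (q ∷ ps)) (length (gaps (q ∷ ps))) (fromℕ (order (q ∷ ps)))
  cofactor-poly-gaps q ps =
    subst (λ l → Poly (cofactor (q ∷ ps)) l (fromℕ (order (q ∷ ps)))) (sym (length-gaps q ps))
      (cofactor-poly q ps)

  nodal-root : ∀ (ps : List Node) → All (λ (p , _) → nodal ps (X p) ≡ 𝟘) ps
  nodal-root []             = []
  nodal-root ((p , α) ∷ ps) =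
    solve 2 (λ x n → (x :- x) :* n := :0) refl (X p) _
    ∷ All.map (λ e → trans (cong (_ ⊗_) e) (solve 1 (λ t → t :* :0 := :0) refl _)) (nodal-root ps)

  ∫-cofactor : ∀ ps → All (λ (a , b) → ∫ a b (λ x → weight ps x ⊗ cofactor ps x) ≡ 𝟘) (gaps ps)
  ∫-cofactor ps = go ps (nodal-root ps)
    where
    -- The recursion runs over a suffix `qs`, while weight, cofactor and roots stay those of the
    -- whole list.
    go : ∀ (qs : List Node) → All (λ (p , _) → nodal ps (X p) ≡ 𝟘) qs →
         All (λ (a , b) → ∫ a b (λ x → weight ps x ⊗ cofactor ps x) ≡ 𝟘) (gaps qs)
    go []       _ = []
    go (_ ∷ []) _ = []
    go ((p , _) ∷ (q , β) ∷ qs) (rp ∷ rq ∷ rs) =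
      trans (∫-derivative (cofactor-derivative ps) p q)
        (trans (cong₂ (λ a b → weight ps (X q) ⊗ a ⊝ weight ps (X p) ⊗ b) rq rp)
          (solve 2 (λ a b → a :* :0 :- b :* :0 := :0) refl _ _))
      ∷ go ((q , β) ∷ qs) (rq ∷ rs)

  andersonIntegral : List Node → C
  andersonIntegral ps = ∫∫ (gaps ps) (λ xs → prod (weight ps) xs ⊗ Δ xs)

  discriminant : List Node → C
  discriminant []             = 𝟙
  discriminant ((p , α) ∷ ps) = prod (λ (q , β) → (X p ⊝ X q) ^^ suc (α + β)) ps ⊗ discriminant ps

  factorials : List Node → ℕ
  factorials []             = 1
  factorials ((p , α) ∷ ps) = α ! * factorials ps

  -- The Dixon-Anderson formula with parameters s_j = α_j + 1 and its denominator cleared: Γ(s_j) is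
  -- α_j!, Γ(Σ s_j) is (order - 1)!, and the exponents in `discriminant` are s_i + s_j - 1.
  Evaluation : List Node → Set
  Evaluation ps = fromℕ (pred (order ps) !) ⊗ andersonIntegral ps ~ fromℕ (factorials ps) ⊗ discriminant ps

  module _ (p k : ℕ) (post : List Node) where
    private
      old new : List Node → List Node
      old pre = pre ++ (p , k) ∷ post
      new pre = pre ++ (p , suc k) ∷ post

    gaps-raise : ∀ pre → gaps (new pre) ≡ gaps (old pre)
    gaps-raise [] = head post
      where
      head : ∀ post → gaps ((p , suc k) ∷ post) ≡ gaps ((p , k) ∷ post)
      head []      = refl
      head (_ ∷ _) = refl
    gaps-raise ((q , _) ∷ [])      = cong ((q , p) ∷_) (gaps-raise [])
    gaps-raise ((q , _) ∷ r ∷ pre) = cong ((q , proj₁ r) ∷_) (gaps-raise (r ∷ pre))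

    order-raise : ∀ pre → order (new pre) ≡ suc (order (old pre))
    order-raise []              = refl
    order-raise ((q , β) ∷ pre) = trans (cong (suc β +_) (order-raise pre)) (ℕ.+-suc (suc β) _)

    order-pos : ∀ pre → suc (pred (order (old pre))) ≡ order (old pre)
    order-pos []      = refl
    order-pos (_ ∷ _) = refl

    weight-raise : ∀ pre x → weight (new pre) x ≡ (x ⊝ X p) ⊗ weight (old pre) x
    weight-raise []              x = solve 3 (λ a b c → a :* b :* c := a :* (b :* c)) refl _ _ _
    weight-raise ((q , β) ∷ pre) x = trans (cong ((x ⊝ X q) ^^ β ⊗_) (weight-raise pre x))
      (solve 3 (λ a b c → a :* (b :* c) := b :* (a :* c)) refl _ _ _)

    factorials-raise : ∀ pre → factorials (new pre) ≡ suc k * factorials (old pre)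
    factorials-raise []              = ℕ.*-assoc (suc k) (k !) (factorials post)
    factorials-raise ((q , β) ∷ pre) = trans (cong (β ! *_) (factorials-raise pre))
      (+-*-Solver.solve 3 (λ a b c → a +-*-Solver.:* (b +-*-Solver.:* c)
         +-*-Solver.:= b +-*-Solver.:* (a +-*-Solver.:* c)) refl (β !) (suc k) _)

    -- In the Leibniz sum only the term in which the factor of p is differentiated survives at
    -- `X p`; every other term still contains x - `X p`.
    cofactor-at-node : ∀ pre → cofactor (old pre) (X p) ≡ fromℕ (suc k) ⊗ nodal (pre ++ post) (X p)
    cofactor-at-node [] = solve 4 (λ a n x r → a :* n :+ (x :- x) :* r := a :* n) refl _ _ (X p) _
    cofactor-at-node ((q , β) ∷ pre) = trans
      (cong₂ (λ a b → fromℕ (suc β) ⊗ a ⊕ (X p ⊝ X q) ⊗ b) root (cofactor-at-node pre))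
      (solve 4 (λ b t k n → b :* :0 :+ t :* (k :* n) := k :* (t :* n)) refl _ _ _ _)
      where
      root : nodal (old pre) (X p) ≡ 𝟘
      root = trans (prod-++ _ pre ((p , k) ∷ post))
        (solve 3 (λ a x b → a :* ((x :- x) :* b) := :0) refl _ (X p) _)

    -- One more exponent at p adds a factor for each other node. For nodes after p it is the factor
    -- of `nodal`; for each node before p it has the opposite sign.
    discriminant-raise : ∀ pre →
      discriminant (new pre) ~ nodal (pre ++ post) (X p) ⊗ discriminant (old pre)
    discriminant-raise [] = inj₁ (trans
      (cong (_⊗ discriminant post) (prod-⊗ (λ (q , _) → X p ⊝ X q) _ post))
      (solve 3 (λ a b c → a :* b :* c := a :* (b :* c)) refl _ _ _))
    discriminant-raise ((q , β) ∷ pre) = ~-trans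
      (~-⊗ (inj₁ {B = row (new pre) ≡ ⊖ ((X q ⊝ X p) ⊗ row (old pre))} (row-raise pre)) (discriminant-raise pre))
      (inj₂ (solve 5 (λ x y r n d → (y :- x) :* r :* (n :* d) := :- ((x :- y) :* n :* (r :* d)))
               refl (X p) (X q) _ _ _))
      where
      row : List Node → C
      row = prod (λ (r , γ) → (X q ⊝ X r) ^^ suc (β + γ))
      row-raise : ∀ pre → row (new pre) ≡ (X q ⊝ X p) ⊗ row (old pre)
      row-raise [] = trans
        (cong (λ n → (X q ⊝ X p) ^^ suc n ⊗ row post) (ℕ.+-suc β k))
        (solve 3 (λ a b c → a :* b :* c := a :* (b :* c)) refl _ _ _)
      row-raise ((r , γ) ∷ pre) = trans (cong ((X q ⊝ X r) ^^ suc (β + γ) ⊗_) (row-raise pre))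
        (solve 3 (λ a b c → a :* (b :* c) := b :* (a :* c)) refl _ _ _)

    -- `raise-weight` at c = `X p` inserts the factors X p - x, whereas `weight` contains x - X p;
    -- together the variables cost the sign (-1)^(number of gaps).
    andersonIntegral-raise : ∀ pre →
      fromℕ (order (old pre)) ⊗ andersonIntegral (new pre) ~ cofactor (old pre) (X p) ⊗ andersonIntegral (old pre)
    andersonIntegral-raise pre = ~-trans (inj₁ flip)
      (~-trans (~-⊗ (-1^n~1 (length (gaps (old pre)))) (inj₁ recur))
        (inj₁ (solve 1 (λ a → :1 :* a := a) refl _)))
      where
      is = gaps (old pre)
      W = weight (old pre)
      s = -1^ length is
      flip-prod : ∀ xs → prod (λ x → (x ⊝ X p) ⊗ W x) xs
                       ≡ -1^ length xs ⊗ prod (λ x → (X p ⊝ x) ⊗ W x) xs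
      flip-prod []       = solve 0 (:1 := :1 :* :1) refl
      flip-prod (x ∷ xs) = trans (cong ((x ⊝ X p) ⊗ W x ⊗_) (flip-prod xs))
        (solve 5 (λ x y w s p → (x :- y) :* w :* (s :* p) := (:- :1) :* s :* ((y :- x) :* w :* p))
          refl x (X p) _ _ _)
      flip : fromℕ (order (old pre)) ⊗ andersonIntegral (new pre)
           ≡ s ⊗ (fromℕ (order (old pre)) ⊗ ∫∫ is (λ xs → prod (λ x → (X p ⊝ x) ⊗ W x) xs ⊗ Δ xs))
      flip = begin
        fromℕ (order (old pre)) ⊗ ∫∫ (gaps (new pre)) (λ xs → prod (weight (new pre)) xs ⊗ Δ xs)
          ≡⟨ cong (λ g → fromℕ (order (old pre)) ⊗ ∫∫ g (λ xs → prod (weight (new pre)) xs ⊗ Δ xs))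
               (gaps-raise pre) ⟩
        fromℕ (order (old pre)) ⊗ ∫∫ is (λ xs → prod (weight (new pre)) xs ⊗ Δ xs)
          ≡⟨ cong (fromℕ (order (old pre)) ⊗_) (∫∫-cong is λ xs l → begin
               prod (weight (new pre)) xs ⊗ Δ xs
                 ≡⟨ cong (_⊗ Δ xs) (trans (prod-cong (weight-raise pre) xs) (flip-prod xs)) ⟩
               -1^ length xs ⊗ prod (λ x → (X p ⊝ x) ⊗ W x) xs ⊗ Δ xs
                 ≡⟨ cong (λ n → -1^ n ⊗ prod (λ x → (X p ⊝ x) ⊗ W x) xs ⊗ Δ xs) l ⟩
               s ⊗ prod (λ x → (X p ⊝ x) ⊗ W x) xs ⊗ Δ xs
                 ≡⟨ solve 3 (λ a b c → a :* b :* c := a :* (b :* c)) refl _ _ _ ⟩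
               s ⊗ (prod (λ x → (X p ⊝ x) ⊗ W x) xs ⊗ Δ xs) ∎) ⟩
        fromℕ (order (old pre)) ⊗ ∫∫ is (λ xs → s ⊗ (prod (λ x → (X p ⊝ x) ⊗ W x) xs ⊗ Δ xs))
          ≡⟨ cong (fromℕ (order (old pre)) ⊗_) (∫∫-* is s _) ⟩
        fromℕ (order (old pre)) ⊗ (s ⊗ ∫∫ is (λ xs → prod (λ x → (X p ⊝ x) ⊗ W x) xs ⊗ Δ xs))
          ≡⟨ solve 3 (λ a b c → a :* (b :* c) := b :* (a :* c)) refl _ _ _ ⟩
        s ⊗ (fromℕ (order (old pre)) ⊗ ∫∫ is (λ xs → prod (λ x → (X p ⊝ x) ⊗ W x) xs ⊗ Δ xs)) ∎

      poly : ∀ pre → Poly (cofactor (old pre)) (length (gaps (old pre))) (fromℕ (order (old pre)))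
      poly []        = cofactor-poly-gaps (p , k) post
      poly (q ∷ pre) = cofactor-poly-gaps q (old pre)

      recur : fromℕ (order (old pre)) ⊗ ∫∫ is (λ xs → prod (λ x → (X p ⊝ x) ⊗ W x) xs ⊗ Δ xs)
            ≡ cofactor (old pre) (X p) ⊗ andersonIntegral (old pre)
      recur = raise-weight W (cofactor (old pre)) is (poly pre) (∫-cofactor (old pre)) (X p)

    -- On the left the old order completes the factorial. On the right `cofactor-at-node` supplies k
    -- + 1, which completes `factorials`, and a value of `nodal`, which completes `discriminant`.
    evaluation-raise : ∀ pre → Evaluation (old pre) → Evaluation (new pre)
    evaluation-raise pre ev = ~-trans (inj₁ lhs) (~-trans
      (~-⊗ {x = f} (inj₁ refl) (andersonIntegral-raise pre)) (~-trans
      (inj₁ (trans (cong (λ c → f ⊗ (c ⊗ andersonIntegral (old pre))) (cofactor-at-node pre))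
               (solve 4 (λ f k n s → f :* (k :* n :* s) := k :* n :* (f :* s)) refl _ _ _ _))) (~-trans
      (~-⊗ {x = fromℕ (suc k) ⊗ n} (inj₁ refl) ev) (~-trans
      (inj₁ (trans (solve 4 (λ k n g d → k :* n :* (g :* d) := k :* g :* (n :* d)) refl _ _ _ _)
               (cong (_⊗ (n ⊗ discriminant (old pre)))
                 (trans (sym (fromℕ-* (suc k) _)) (cong fromℕ (sym (factorials-raise pre)))))))
      (~-⊗ {x = fromℕ (factorials (new pre))} (inj₁ refl) (~-sym (discriminant-raise pre)))))))
      where
      f = fromℕ (pred (order (old pre)) !)
      n = nodal (pre ++ post) (X p)
      lhs : fromℕ (pred (order (new pre)) !) ⊗ andersonIntegral (new pre)
          ≡ f ⊗ (fromℕ (order (old pre)) ⊗ andersonIntegral (new pre))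
      lhs = begin
        fromℕ (pred (order (new pre)) !) ⊗ andersonIntegral (new pre)
          ≡⟨ cong (λ o → fromℕ (pred o !) ⊗ andersonIntegral (new pre)) (order-raise pre) ⟩
        fromℕ (order (old pre) !) ⊗ andersonIntegral (new pre)
          -- Writing the order as a successor lets its factorial unfold into the order times the
          -- previous factorial.
          ≡⟨ cong (λ o → fromℕ (o !) ⊗ andersonIntegral (new pre)) (order-pos pre) ⟨
        fromℕ (suc (pred (order (old pre))) * pred (order (old pre)) !) ⊗ andersonIntegral (new pre)
          ≡⟨ cong (_⊗ andersonIntegral (new pre)) (fromℕ-* (suc (pred (order (old pre)))) _) ⟩
        fromℕ (suc (pred (order (old pre)))) ⊗ f ⊗ andersonIntegral (new pre)
          ≡⟨ cong (λ o → fromℕ o ⊗ f ⊗ andersonIntegral (new pre)) (order-pos pre) ⟩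
        fromℕ (order (old pre)) ⊗ f ⊗ andersonIntegral (new pre)
          ≡⟨ solve 3 (λ a b c → a :* b :* c := b :* (a :* c)) refl _ _ _ ⟩
        f ⊗ (fromℕ (order (old pre)) ⊗ andersonIntegral (new pre)) ∎

  simple : List ℕ → List Node
  simple = map (_, 0)

  simple-weight : ∀ ps x → weight (simple ps) x ≡ 𝟙
  simple-weight []       x = refl
  simple-weight (p ∷ ps) x = trans (cong (𝟙 ⊗_) (simple-weight ps x)) (solve 0 (:1 :* :1 := :1) refl)

  order-simple : ∀ ps → order (simple ps) ≡ length ps
  order-simple []       = refl
  order-simple (p ∷ ps) = cong suc (order-simple ps)

  factorials-simple : ∀ ps → factorials (simple ps) ≡ 1
  factorials-simple []       = refl
  factorials-simple (p ∷ ps) = trans (ℕ.+-identityʳ _) (factorials-simple ps)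

  -- The interpolated function is the derivative of the nodal product of the nodes after p. It
  -- integrates to 0 over every later gap and to minus `nodal qs (X p)` over the first one, since X
  -- q is a root; up to sign this is the row of p in the discriminant.
  ∫∫Δ-simple : ∀ p ps →
    fromℕ (length ps !) ⊗ ∫∫ (gaps (simple (p ∷ ps))) Δ ~ discriminant (simple (p ∷ ps))
  ∫∫Δ-simple p [] = inj₁ refl
  ∫∫Δ-simple p (q ∷ ps) = ~-trans (inj₁ lhs) (~-trans
    (~-⊗ (inj₂ {A = ∫ p q Q ≡ nodal qs (X p)} ∫Q) (∫∫Δ-simple q ps))
    (inj₁ (cong (_⊗ discriminant qs) (sym (row (q ∷ ps))))))
    where
    qs = simple (q ∷ ps)
    Q = cofactor qs
    I = ∫∫ (gaps qs) Δ
    cleared : ∀ a b → ∫ a b Q ≡ ∫ a b (λ x → weight qs x ⊗ cofactor qs x)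
    cleared a b = ∫-cong a b λ x → trans (solve 1 (λ a → a := :1 :* a) refl _)
      (cong (_⊗ cofactor qs x) (sym (simple-weight (q ∷ ps) x)))
    all-zero : All (λ (a , b) → ∫ a b Q ≡ 𝟘) (gaps qs)
    all-zero = All.map (λ {(a , b)} e → trans (cleared a b) e) (∫-cofactor qs)
    poly : Poly Q (length (gaps qs)) (fromℕ (order qs))
    poly = cofactor-poly-gaps (q , 0) (simple ps)
    ∫Q : ∫ p q Q ≡ ⊖ nodal qs (X p)
    ∫Q = trans (cleared p q) (trans (∫-derivative (cofactor-derivative qs) p q)
      (trans (cong₂ (λ a b → a ⊗ nodal qs (X q) ⊝ b ⊗ nodal qs (X p))
               (simple-weight (q ∷ ps) (X q)) (simple-weight (q ∷ ps) (X p)))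
        (solve 3 (λ x n m → :1 :* ((x :- x) :* n) :- :1 :* m := :- m) refl (X q) _ _)))
    row : ∀ ps → prod (λ (r , γ) → (X p ⊝ X r) ^^ suc (0 + γ)) (simple ps) ≡ nodal (simple ps) (X p)
    row []       = refl
    row (r ∷ ps) = cong₂ _⊗_ (solve 1 (λ a → a :* :1 := a) refl _) (row ps)
    lhs : fromℕ (suc (length ps) * length ps !) ⊗ ∫∫ ((p , q) ∷ gaps qs) Δ
        ≡ ∫ p q Q ⊗ (fromℕ (length ps !) ⊗ I)
    lhs = begin
      fromℕ (suc (length ps) * length ps !) ⊗ ∫∫ ((p , q) ∷ gaps qs) Δ
        ≡⟨ cong (_⊗ ∫∫ ((p , q) ∷ gaps qs) Δ) (fromℕ-* (suc (length ps)) _) ⟩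
      fromℕ (suc (length ps)) ⊗ fromℕ (length ps !) ⊗ ∫∫ ((p , q) ∷ gaps qs) Δ
        ≡⟨ solve 3 (λ a b c → a :* b :* c := b :* (a :* c)) refl _ _ _ ⟩
      fromℕ (length ps !) ⊗ (fromℕ (suc (length ps)) ⊗ ∫∫ ((p , q) ∷ gaps qs) Δ)
        ≡⟨ cong (λ o → fromℕ (length ps !) ⊗ (fromℕ o ⊗ ∫∫ ((p , q) ∷ gaps qs) Δ)) (order-simple (q ∷ ps)) ⟨
      fromℕ (length ps !) ⊗ (fromℕ (order qs) ⊗ ∫∫ ((p , q) ∷ gaps qs) Δ)
        ≡⟨ cong (fromℕ (length ps !) ⊗_) (drop-first-variable Q p q (gaps qs) poly all-zero) ⟩
      fromℕ (length ps !) ⊗ (∫ p q Q ⊗ I)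
        ≡⟨ solve 3 (λ a b c → a :* (b :* c) := b :* (a :* c)) refl _ _ _ ⟩
      ∫ p q Q ⊗ (fromℕ (length ps !) ⊗ I) ∎

  evaluation-simple : ∀ ps → Evaluation (simple ps)
  evaluation-simple []       = inj₁ (solve 0 (:1 :* (:1 :* :1) := :1 :* :1) refl)
  evaluation-simple (p ∷ ps) = ~-trans (inj₁ lhs) (~-trans (∫∫Δ-simple p ps)
    (inj₁ (trans (solve 1 (λ d → d := :1 :* d) refl _)
      (cong (λ n → fromℕ n ⊗ discriminant (simple (p ∷ ps))) (sym (factorials-simple (p ∷ ps)))))))
    where
    lhs : fromℕ (order (simple ps) !) ⊗ andersonIntegral (simple (p ∷ ps))
        ≡ fromℕ (length ps !) ⊗ ∫∫ (gaps (simple (p ∷ ps))) Δ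
    lhs = cong₂ (λ o s → fromℕ (o !) ⊗ s) (order-simple ps)
      (∫∫-cong (gaps (simple (p ∷ ps))) λ xs _ → trans
        (cong (_⊗ Δ xs) (prod-one (simple-weight (p ∷ ps)) xs))
        (solve 1 (λ d → :1 :* d := d) refl _))

  -- All exponents start at 0 over the same points and are raised node by node from the left: `pre`
  -- is finished, the nodes after it are still simple.
  evaluation : ∀ ps → Evaluation ps
  evaluation ps = raise-all [] ps (evaluation-simple (map proj₁ ps))
    where
    raise-one : ∀ pre p k post → Evaluation (pre ++ (p , 0) ∷ post) → Evaluation (pre ++ (p , k) ∷ post)
    raise-one pre p zero    post ev = ev
    raise-one pre p (suc k) post ev = evaluation-raise p k post pre (raise-one pre p k post ev)

    raise-all : ∀ pre ps → Evaluation (pre ++ simple (map proj₁ ps)) → Evaluation (pre ++ ps)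
    raise-all pre []             ev = ev
    raise-all pre ((p , α) ∷ ps) ev = subst Evaluation (List.++-assoc pre [ (p , α) ] ps)
      (raise-all (pre ++ [ (p , α) ]) ps
        (subst Evaluation (sym (List.++-assoc pre [ (p , α) ] (simple (map proj₁ ps))))
          (raise-one pre p α (simple (map proj₁ ps)) ev)))

-- Finite setoids and their cardinalities

-- Orderings are functions compared pointwise, so cardinality refers to the setoid equality. Only
-- `index` carries a congruence law; `enum` respects propositional equality automatically.
record Counted (S : Setoid 0ℓ 0ℓ) (k : ℕ) : Set where
  open Setoid S
  field
    enum       : Fin k → Carrier
    index      : Carrier → Fin k
    index-cong : ∀ {x y} → x ≈ y → index x ≡ index y
    index-enum : ∀ i → index (enum i) ≡ i
    enum-index : ∀ x → enum (index x) ≈ x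

module _ {S T : Setoid 0ℓ 0ℓ} where
  private
    module S = Setoid S
    module T = Setoid T

  counted-bijection : ∀ {k} → Counted S k → Counted T k → Bijection S T
  counted-bijection cS cT = record
    { to        = λ x → cT.enum (cS.index x)
    ; cong      = λ x≈y → T.reflexive (cong cT.enum (cS.index-cong x≈y))
    ; bijective = injective , surjective }
    where
    module cS = Counted cS
    module cT = Counted cT
    injective : ∀ {x y} → cT.enum (cS.index x) T.≈ cT.enum (cS.index y) → x S.≈ y
    injective {x} {y} e = S.trans (S.sym (cS.enum-index x)) (S.trans
      (S.reflexive (cong cS.enum
        (trans (sym (cT.index-enum _)) (trans (cT.index-cong e) (cT.index-enum _)))))
      (cS.enum-index y))
    surjective : ∀ y → ∃ λ x → ∀ {x′} → x′ S.≈ x → cT.enum (cS.index x′) T.≈ y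
    surjective y = cS.enum (cT.index y) , λ x′≈x → T.trans
      (T.reflexive (cong cT.enum (trans (cS.index-cong x′≈x) (cS.index-enum _))))
      (cT.enum-index y)

  counted-map : ∀ {k} (φ : S.Carrier → T.Carrier) (ψ : T.Carrier → S.Carrier) →
    (∀ {x y} → x S.≈ y → φ x T.≈ φ y) → (∀ {x y} → x T.≈ y → ψ x S.≈ ψ y) →
    (∀ x → φ (ψ x) T.≈ x) → (∀ x → ψ (φ x) S.≈ x) → Counted S k → Counted T k
  counted-map φ ψ φ-cong ψ-cong φψ ψφ c = record
    { enum       = λ i → φ (enum i)
    ; index      = λ x → index (ψ x)
    ; index-cong = λ e → index-cong (ψ-cong e)
    ; index-enum = λ i → trans (index-cong (ψφ (enum i))) (index-enum i)
    ; enum-index = λ x → T.trans (φ-cong (enum-index (ψ x))) (φψ x) }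
    where open Counted c

  counted-× : ∀ {a b} → Counted S a → Counted T b → Counted (×-setoid S T) (a * b)
  counted-× {a} {b} cS cT = record
    { enum       = λ i → cS.enum (proj₁ (remQuot {a} b i)) , cT.enum (proj₂ (remQuot {a} b i))
    ; index      = λ (x , y) → combine (cS.index x) (cT.index y)
    ; index-cong = λ (e , e′) → cong₂ combine (cS.index-cong e) (cT.index-cong e′)
    ; index-enum = λ i → trans
        (cong₂ combine (cS.index-enum (proj₁ (remQuot {a} b i))) (cT.index-enum (proj₂ (remQuot {a} b i))))
        (Fin.combine-remQuot {a} b i)
    ; enum-index = λ (x , y) →
        let e = Fin.remQuot-combine {a} {b} (cS.index x) (cT.index y) in
        S.trans (S.reflexive (cong (cS.enum ∘ proj₁) e)) (cS.enum-index x)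
        , T.trans (T.reflexive (cong (cT.enum ∘ proj₂) e)) (cT.enum-index y) }
    where
    module cS = Counted cS
    module cT = Counted cT

counted-Fin : ∀ k → Counted (setoid (Fin k)) k
counted-Fin k = record
  { enum = λ i → i ; index = λ i → i ; index-cong = λ e → e
  ; index-enum = λ _ → refl ; enum-index = λ _ → refl }

counted-empty : {S : Setoid 0ℓ 0ℓ} → (Setoid.Carrier S → ⊥) → Counted S 0
counted-empty ¬S = record
  { enum = λ () ; index = λ x → ⊥-elim (¬S x) ; index-cong = λ {x} _ → ⊥-elim (¬S x)
  ; index-enum = λ () ; enum-index = λ x → ⊥-elim (¬S x) }

join : ∀ {n} (k : Fin n → ℕ) (x : Fin n) → Fin (k x) → Fin (sumF k)
join k zero    j = j ↑ˡ _
join k (suc x) j = k zero ↑ʳ join (k ∘ suc) x j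

split : ∀ {n} (k : Fin n → ℕ) → Fin (sumF k) → Σ (Fin n) (Fin ∘ k)
split {suc n} k i = [ (λ j → zero , j) , (λ j → let (x , l) = split (k ∘ suc) j in suc x , l) ]′
                    (splitAt (k zero) i)

split-join : ∀ {n} (k : Fin n → ℕ) x j → split k (join k x j) ≡ (x , j)
split-join k zero    j rewrite Fin.splitAt-↑ˡ (k zero) j (sumF (k ∘ suc)) = refl
split-join k (suc x) j
  rewrite Fin.splitAt-↑ʳ (k zero) (sumF (k ∘ suc)) (join (k ∘ suc) x j) | split-join (k ∘ suc) x j = refl

join-split : ∀ {n} (k : Fin n → ℕ) i → join k (proj₁ (split k i)) (proj₂ (split k i)) ≡ i
join-split {suc n} k i with splitAt (k zero) i in eq
... | inj₁ j = Fin.splitAt⁻¹-↑ˡ eq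
... | inj₂ j = trans (cong (k zero ↑ʳ_) (join-split (k ∘ suc) j)) (Fin.splitAt⁻¹-↑ʳ eq)

fiber : {I : Set} (S : Setoid 0ℓ 0ℓ) → (Setoid.Carrier S → I) → I → Setoid 0ℓ 0ℓ
fiber S f i = record
  { Carrier = Σ S.Carrier (λ x → f x ≡ i)
  ; _≈_ = λ x y → proj₁ x S.≈ proj₁ y
  ; isEquivalence = record { refl = S.refl ; sym = S.sym ; trans = S.trans } }
  where module S = Setoid S

counted-fibers : ∀ {n} {S : Setoid 0ℓ 0ℓ} (f : Setoid.Carrier S → Fin n) →
  (∀ {x y} → Setoid._≈_ S x y → f x ≡ f y) → {k : Fin n → ℕ} →
  (∀ i → Counted (fiber S f i) (k i)) → Counted S (sumF k)
counted-fibers {n} {S} f f-cong {k} c = record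
  { enum       = λ i → let (x , j) = split k i in proj₁ (c.enum x j)
  ; index      = λ x → index-at x (f x) refl
  ; index-cong = λ {x} {y} x≈y → index-at-cong x≈y (f-cong x≈y) refl refl
  ; index-enum = λ i → let (x , j) = split k i in
      trans (index-at-eq (proj₁ (c.enum x j)) (proj₂ (c.enum x j)))
        (trans (cong (join k x) (c.index-enum x j)) (join-split k i))
  ; enum-index = λ x → S.trans
      (S.reflexive (cong (λ (i , j) → proj₁ (c.enum i j)) (split-join k (f x) (c.index (f x) (x , refl)))))
      (c.enum-index (f x) (x , refl)) }
  where
  module S = Setoid S
  module c i = Counted (c i)
  -- The fiber is named by a variable i with a proof, so that matching on `refl` can identify the
  -- fibers of x and y, for which f x and f y agree only propositionally.
  index-at : ∀ x i → f x ≡ i → Fin (sumF k)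
  index-at x i e = join k i (c.index i (x , e))
  index-at-cong : ∀ {x y i j} → x S.≈ y → i ≡ j → (e : f x ≡ i) (e′ : f y ≡ j) →
                  index-at x i e ≡ index-at y j e′
  index-at-cong {i = i} x≈y refl e e′ = cong (join k i) (c.index-cong i x≈y)
  index-at-eq : ∀ x {i} (e : f x ≡ i) → index-at x (f x) refl ≡ index-at x i e
  index-at-eq x refl = refl

prodF : ∀ {m} → (Fin m → ℕ) → ℕ
prodF {zero}  a = 1
prodF {suc m} a = a zero * prodF (a ∘ suc)

counted-Π : ∀ {m} (a : Fin m → ℕ) → Counted (Π-Fin-setoid a) (prodF a)
counted-Π {zero} a = record
  { enum = λ _ () ; index = λ _ → zero ; index-cong = λ _ → refl
  ; index-enum = λ { zero → refl } ; enum-index = λ _ () }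
counted-Π {suc m} a = counted-map
  (λ (x , g) → λ { zero → x ; (suc i) → g i })
  (λ g → g zero , g ∘ suc)
  (λ (e , e′) → λ { zero → e ; (suc i) → e′ i })
  (λ e → e zero , e ∘ suc)
  (λ g → λ { zero → refl ; (suc i) → refl })
  (λ _ → refl , λ _ → refl)
  (counted-× (counted-Fin (a zero)) (counted-Π (a ∘ suc)))

-- Top coefficients and monomials

module BigOps (R : ℤ-Algebra) where
  open ℤ-Algebra R
  open CommutativeMonoidSum (CommutativeRing.*-commutativeMonoid commutativeRing) public
    using () renaming (sum to ∏; sum-cong-≗ to ∏-cong; sum-remove to ∏-remove; sum-permute to ∏-permute)
  open SemiringSum (CommutativeRing.semiring commutativeRing) public
    using () renaming (sum to ∑; sum-cong-≗ to ∑-cong; *-distribˡ-sum to ∑-distribˡ; *-distribʳ-sum to ∑-distribʳ)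

top-⊕ : ∀ N x y → top N (Sq._⊕_ N x y) ≡ top N x ℤ.+ top N y
top-⊕ zero    x y = refl
top-⊕ (suc N) (_ , x) (_ , y) = top-⊕ N x y

top-𝟘 : ∀ N → top N (Sq.𝟘 N) ≡ ℤ.0ℤ
top-𝟘 zero    = refl
top-𝟘 (suc N) = top-𝟘 N

top-⊖ : ∀ N x → top N (Sq.⊖_ N x) ≡ ℤ.- top N x
top-⊖ zero    x       = refl
top-⊖ (suc N) (_ , x) = top-⊖ N x

top-ι : ∀ N a x → top N (Sq._⊗_ N (Sq.ι N a) x) ≡ a ℤ.* top N x
top-ι zero    a x       = refl
top-ι (suc N) a (x , y) = trans
  (cong (top N) (solve 3 (λ a x y → a :* y :+ :0 :* x := a :* y) refl (Sq.ι N a) x y))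
  (top-ι N a y)
  where open Solver (Squarefree N)

var² : ∀ N t → Sq._⊗_ N (var N t) (var N t) ≡ Sq.𝟘 N
var² zero    t       = refl
var² (suc N) zero    = cong₂ _,_ (solve 0 (:0 :* :0 := :0) refl) (solve 0 (:0 :* :1 :+ :1 :* :0 := :0) refl)
  where open Solver (Squarefree N)
var² (suc N) (suc t) = cong₂ _,_ (var² N t) (solve 1 (λ x → x :* :0 :+ :0 :* x := :0) refl (var N t))
  where open Solver (Squarefree N)

var-beyond : ∀ N t → N ≤ t → var N t ≡ Sq.𝟘 N
var-beyond zero    t       _       = refl
var-beyond (suc N) (suc t) (s≤s p) = cong (_, Sq.𝟘 N) (var-beyond N t p)

variable-product : ∀ N → Sq.Carrier N
variable-product N = BigOps.∏ (Squarefree N) {N} (λ i → var N (toℕ i))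

top-variables : ∀ N → top N (variable-product N) ≡ ℤ.1ℤ
top-variables zero    = refl
top-variables (suc N) = begin
  top N (proj₂ ((𝟘 , 𝟙) ⊗ᴰ ∏ᴰ {N} (λ i → (var N (toℕ i) , 𝟘))))
    ≡⟨ cong (λ x → top N (proj₂ ((𝟘 , 𝟙) ⊗ᴰ x))) (lift {N} (λ i → var N (toℕ i))) ⟩
  top N (𝟘 ⊗ 𝟘 ⊕ 𝟙 ⊗ variable-product N)
    ≡⟨ cong (top N) (solve 1 (λ x → :0 :* :0 :+ :1 :* x := x) refl _) ⟩
  top N (variable-product N)
    ≡⟨ top-variables N ⟩
  ℤ.1ℤ ∎
  where
  open ℤ-Algebra (Squarefree N)
  open Solver (Squarefree N)
  open BigOps (Squarefree N)
  open ℤ-Algebra (dual (Squarefree N)) using () renaming (_⊗_ to _⊗ᴰ_)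
  open BigOps (dual (Squarefree N)) using () renaming (∏ to ∏ᴰ)
  lift : ∀ {n} (g : Fin n → Carrier) → ∏ᴰ (λ i → (g i , 𝟘)) ≡ (∏ g , 𝟘)
  lift {zero}  g = refl
  lift {suc n} g = trans (cong ((g zero , 𝟘) ⊗ᴰ_) (lift (g ∘ suc)))
    (cong (g zero ⊗ ∏ (g ∘ suc) ,_) (solve 2 (λ a b → a :* :0 :+ :0 :* b := :0) refl _ _))

-- The element 0 and the products of distinct variables. They are closed under multiplication and
-- have top coefficient 0 or 1, so that each choice of positions contributes 0 or 1 to a count.
Monomial : ∀ N → Sq.Carrier N → Set
Monomial zero    x = x ≡ ℤ.0ℤ ⊎ x ≡ ℤ.1ℤ
Monomial (suc N) x = x ≡ (Sq.𝟘 N , Sq.𝟘 N)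
                   ⊎ ∃ λ y → Monomial N y × (x ≡ (y , Sq.𝟘 N) ⊎ x ≡ (Sq.𝟘 N , y))

monomial-𝟙 : ∀ N → Monomial N (Sq.𝟙 N)
monomial-𝟙 zero    = inj₂ refl
monomial-𝟙 (suc N) = inj₂ (Sq.𝟙 N , monomial-𝟙 N , inj₁ refl)

monomial-var : ∀ N t → Monomial N (var N t)
monomial-var zero    t       = inj₁ refl
monomial-var (suc N) zero    = inj₂ (Sq.𝟙 N , monomial-𝟙 N , inj₂ refl)
monomial-var (suc N) (suc t) = inj₂ (var N t , monomial-var N t , inj₁ refl)

monomial-⊗ : ∀ N {x y} → Monomial N x → Monomial N y → Monomial N (Sq._⊗_ N x y)
monomial-⊗ zero    (inj₁ refl) _           = inj₁ refl
monomial-⊗ zero    (inj₂ refl) (inj₁ refl) = inj₁ refl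
monomial-⊗ zero    (inj₂ refl) (inj₂ refl) = inj₂ refl
monomial-⊗ (suc N) {y = a , b} (inj₁ refl) _ = inj₁ (cong₂ _,_
  (solve 1 (λ a → :0 :* a := :0) refl a) (solve 2 (λ a b → :0 :* b :+ :0 :* a := :0) refl a b))
  where open Solver (Squarefree N)
monomial-⊗ (suc N) {x = a , b} (inj₂ _) (inj₁ refl) = inj₁ (cong₂ _,_
  (solve 1 (λ a → a :* :0 := :0) refl a) (solve 2 (λ a b → a :* :0 :+ b :* :0 := :0) refl a b))
  where open Solver (Squarefree N)
monomial-⊗ (suc N) (inj₂ (x , mx , inj₁ refl)) (inj₂ (y , my , inj₁ refl)) =
  inj₂ (_ , monomial-⊗ N mx my , inj₁ (cong (Sq._⊗_ N x y ,_) (solve 2 (λ x y → x :* :0 :+ :0 :* y := :0) refl x y)))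
  where open Solver (Squarefree N)
monomial-⊗ (suc N) (inj₂ (x , mx , inj₁ refl)) (inj₂ (y , my , inj₂ refl)) =
  inj₂ (_ , monomial-⊗ N mx my , inj₂ (cong₂ _,_ (solve 1 (λ x → x :* :0 := :0) refl x)
                                         (solve 2 (λ x y → x :* y :+ :0 :* :0 := x :* y) refl x y)))
  where open Solver (Squarefree N)
monomial-⊗ (suc N) (inj₂ (x , mx , inj₂ refl)) (inj₂ (y , my , inj₁ refl)) =
  inj₂ (_ , monomial-⊗ N mx my , inj₂ (cong₂ _,_ (solve 1 (λ y → :0 :* y := :0) refl y)
                                         (solve 2 (λ x y → :0 :* :0 :+ x :* y := x :* y) refl x y)))
  where open Solver (Squarefree N)
monomial-⊗ (suc N) (inj₂ (x , mx , inj₂ refl)) (inj₂ (y , my , inj₂ refl)) = inj₁ (cong₂ _,_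
  (solve 0 (:0 :* :0 := :0) refl) (solve 2 (λ x y → :0 :* y :+ x :* :0 := :0) refl x y))
  where open Solver (Squarefree N)

top-monomial : ∀ N {x} → Monomial N x → top N x ≡ ℤ.0ℤ ⊎ top N x ≡ ℤ.1ℤ
top-monomial zero    m                          = m
top-monomial (suc N) (inj₁ refl)                = inj₁ (top-𝟘 N)
top-monomial (suc N) (inj₂ (y , my , inj₁ refl)) = inj₁ (top-𝟘 N)
top-monomial (suc N) (inj₂ (y , my , inj₂ refl)) = top-monomial N my

injective⇒permutation : ∀ {n} (f : Fin n → Fin n) → Injective _≡_ _≡_ f →
                        Σ (Perm.Permutation n n) λ π → ∀ i → π Perm.⟨$⟩ʳ i ≡ f i
injective⇒permutation {n} f inj =
  Perm.permutation f (λ y → proj₁ (surj y)) (λ y → proj₂ (surj y)) (λ x → inj (proj₂ (surj (f x)))) , λ _ → refl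
  where
  -- Punching a missed value y out of the target would leave an injection of `Fin (suc n)` into
  -- `Fin n`.
  miss : ∀ {n} (f : Fin n → Fin n) → Injective _≡_ _≡_ f → ∀ y → (∀ x → y ≢ f x) → ⊥
  miss {suc n} f inj y y∉f = ℕ.1+n≰n (Fin.injective⇒≤ {f = λ x → punchOut (y∉f x)}
    (λ {a} {b} e → inj (Fin.punchOut-injective (y∉f a) (y∉f b) e)))
  surj : ∀ y → ∃ λ x → f x ≡ y
  surj y with Fin.any? (λ x → f x Fin.≟ y)
  ... | yes found = found
  ... | no  none  = ⊥-elim (miss f inj y (λ x e → none (x , sym e)))

-- Choices of distinct positions counted by top coefficients

module Bijections (N : ℕ) where
  open ℤ-Algebra (Squarefree N) renaming (Carrier to C)
  open Solver (Squarefree N)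
  open BigOps (Squarefree N)

  v : Fin N → C
  v x = var N (toℕ x)

  top-injective : ∀ f → Injective _≡_ _≡_ f → top N (∏ (v ∘ f)) ≡ ℤ.1ℤ
  top-injective f inj = begin
    top N (∏ (v ∘ f))                  ≡⟨ cong (top N) (∏-cong {N} (λ i → cong v (π≗f i))) ⟨
    top N (∏ (v ∘ (π Perm.⟨$⟩ʳ_)))     ≡⟨ cong (top N) (∏-permute v π) ⟨
    top N (∏ v)                        ≡⟨ top-variables N ⟩
    ℤ.1ℤ                               ∎
    where
    π = proj₁ (injective⇒permutation f inj)
    π≗f = proj₂ (injective⇒permutation f inj)

  ∏-square : ∀ {M} (f : Fin M → Fin N) i j → i ≢ j → f i ≡ f j → ∏ (v ∘ f) ≡ 𝟘
  ∏-square {suc zero}    f zero zero i≢j _ = ⊥-elim (i≢j refl)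
  ∏-square {suc (suc M)} f i j i≢j e = begin
    ∏ (v ∘ f)
      ≡⟨ ∏-remove {i = i} (v ∘ f) ⟩
    v (f i) ⊗ ∏ (Vector.removeAt (v ∘ f) i)
      ≡⟨ cong (v (f i) ⊗_) (∏-remove {i = punchOut i≢j} (Vector.removeAt (v ∘ f) i)) ⟩
    v (f i) ⊗ (v (f (punchIn i (punchOut i≢j))) ⊗ r)
      ≡⟨ cong (λ x → v (f i) ⊗ (v x ⊗ r)) (trans (cong f (Fin.punchIn-punchOut i≢j)) (sym e)) ⟩
    v (f i) ⊗ (v (f i) ⊗ r)
      ≡⟨ solve 2 (λ a b → a :* (a :* b) := a :* a :* b) refl _ _ ⟩
    v (f i) ⊗ v (f i) ⊗ r
      ≡⟨ cong (_⊗ r) (var² N (toℕ (f i))) ⟩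
    𝟘 ⊗ r
      ≡⟨ solve 1 (λ a → :0 :* a := :0) refl _ ⟩
    𝟘 ∎
    where
    r = ∏ (Vector.removeAt (Vector.removeAt (v ∘ f) i) (punchOut i≢j))

  -- Two equal values would produce a square, hence top coefficient 0 instead of 1.
  injective-top : ∀ {M} (f : Fin M → Fin N) → top N (∏ (v ∘ f)) ≡ ℤ.1ℤ → Injective _≡_ _≡_ f
  injective-top f e {i} {j} fi≡fj with i Fin.≟ j
  ... | yes i≡j = i≡j
  ... | no  i≢j with () ← trans (sym e) (trans (cong (top N) (∏-square f i j i≢j fi≡fj)) (top-𝟘 N))

  select : (Fin N → Bool) → C
  select S = ∑ (λ x → if S x then v x else 𝟘)

  -- The maps f with f i ∈ S i for which y ∏ z_{f i} is the product of all variables.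
  Completions : (M : ℕ) → (Fin M → Fin N → Bool) → C → Setoid 0ℓ 0ℓ
  Completions M S y = record
    { Carrier = Σ (Fin M → Fin N) λ f → (∀ i → S i (f i) ≡ true) × top N (y ⊗ ∏ (v ∘ f)) ≡ ℤ.1ℤ
    ; _≈_ = λ f g → ∀ i → proj₁ f i ≡ proj₁ g i
    ; isEquivalence = record
      { refl = λ _ → refl ; sym = λ e i → sym (e i) ; trans = λ e e′ i → trans (e i) (e′ i) } }

  +-sumF : ∀ {n} (k : Fin n → ℕ) (g : Fin n → C) → (∀ i → ℤ.+ k i ≡ top N (g i)) → ℤ.+ sumF k ≡ top N (∑ g)
  +-sumF {zero}  k g e = sym (top-𝟘 N)
  +-sumF {suc n} k g e = trans (cong₂ ℤ._+_ (e zero) (+-sumF (k ∘ suc) (g ∘ suc) (e ∘ suc)))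
    (sym (top-⊕ N _ _))

  -- The monomial y collects the variables already used. Expanding the factor `select (S zero)`
  -- splits the product just as the value of f at 0 splits the completions; a position used before
  -- turns y into 0 and so drops out without a test.
  completions : ∀ M S y → Monomial N y →
    ∃ λ k → Counted (Completions M S y) k × ℤ.+ k ≡ top N (y ⊗ ∏ (λ i → select (S i)))
  -- Nothing is left to choose: there is one completion or none, according to the top coefficient of
  -- y.
  completions zero S y my with top-monomial N (monomial-⊗ N my (monomial-𝟙 N))
  ... | inj₁ e = 0 , counted-empty (λ (_ , _ , e′) → 0≢1 (trans (sym e) e′)) , sym e
    where
    0≢1 : ℤ.0ℤ ≡ ℤ.1ℤ → ⊥
    0≢1 ()
  ... | inj₂ e = 1 , record
    { enum = λ _ → (λ ()) , (λ ()) , e ; index = λ _ → zero ; index-cong = λ _ → refl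
    ; index-enum = λ { zero → refl } ; enum-index = λ _ () } , sym e
  completions (suc M) S y my =
    sumF (λ x → proj₁ (at x))
    , counted-fibers (λ f → proj₁ f zero) (λ e → e zero) (λ x → proj₁ (proj₂ (at x)))
    , trans (+-sumF (λ x → proj₁ (at x)) _ (λ x → proj₂ (proj₂ (at x)))) (cong (top N) (begin
        ∑ (λ x → y ⊗ (if S zero x then v x else 𝟘) ⊗ rest)
          ≡⟨ ∑-distribʳ {N} rest (λ x → y ⊗ (if S zero x then v x else 𝟘)) ⟨
        ∑ (λ x → y ⊗ (if S zero x then v x else 𝟘)) ⊗ rest
          ≡⟨ cong (_⊗ rest) (∑-distribˡ {N} y (λ x → if S zero x then v x else 𝟘)) ⟨
        y ⊗ select (S zero) ⊗ rest
          ≡⟨ solve 3 (λ a b c → a :* b :* c := a :* (b :* c)) refl _ _ _ ⟩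
        y ⊗ (select (S zero) ⊗ rest) ∎))
    where
    rest = ∏ (λ i → select (S (suc i)))
    at : ∀ x → ∃ λ k → Counted (fiber (Completions (suc M) S y) (λ f → proj₁ f zero) x) k
                       × ℤ.+ k ≡ top N (y ⊗ (if S zero x then v x else 𝟘) ⊗ rest)
    at x with S zero x in Sx
    ... | true with k , c , e ← completions M (S ∘ suc) (y ⊗ v x) (monomial-⊗ N my (monomial-var N (toℕ x))) =
      k , counted-map
        (λ (f , s , t) → ((λ { zero → x ; (suc i) → f i }) , (λ { zero → Sx ; (suc i) → s i })
                         , trans (cong (top N) (reassoc (∏ (v ∘ f)))) t) , refl)
        (λ ((f , s , t) , fx) → f ∘ suc , s ∘ suc
           , trans (cong (top N) (trans (cong (λ x → y ⊗ v x ⊗ ∏ (v ∘ f ∘ suc)) (sym fx)) (sym (reassoc′ f)))) t)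
        (λ e → λ { zero → refl ; (suc i) → e i })
        (λ e i → e (suc i))
        (λ (_ , fx) → λ { zero → sym fx ; (suc i) → refl })
        (λ _ _ → refl)
        c , e
      where
      reassoc : ∀ r → y ⊗ (v x ⊗ r) ≡ y ⊗ v x ⊗ r
      reassoc r = solve 3 (λ a b c → a :* (b :* c) := a :* b :* c) refl y (v x) r
      reassoc′ : ∀ f → y ⊗ ∏ (v ∘ f) ≡ y ⊗ v (f zero) ⊗ ∏ (v ∘ f ∘ suc)
      reassoc′ f = solve 3 (λ a b c → a :* (b :* c) := a :* b :* c) refl y _ _
    ... | false = 0 , counted-empty (λ ((f , s , _) , fx) → true≢false (trans (sym (s zero)) (trans (cong (S zero) fx) Sx)))
                , sym (trans (cong (top N) (solve 2 (λ a b → a :* :0 :* b := :0) refl y rest)) (top-𝟘 N))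
      where
      true≢false : true ≡ false → ⊥
      true≢false ()

-- Ranges of positions and their sums

≡ᵇ-sound : ∀ m n → (m ≡ᵇ n) ≡ true → m ≡ n
≡ᵇ-sound zero    zero    _ = refl
≡ᵇ-sound (suc m) (suc n) e = cong suc (≡ᵇ-sound m n e)

≡ᵇ-refl : ∀ n → (n ≡ᵇ n) ≡ true
≡ᵇ-refl zero    = refl
≡ᵇ-refl (suc n) = ≡ᵇ-refl n

-- a ≤ t < b
inRange : ℕ → ℕ → ℕ → Bool
inRange a b t = not (t <ᵇ a) ∧ (t <ᵇ b)

inRange-sound : ∀ a b t → inRange a b t ≡ true → a ≤ t × t < b
inRange-sound zero    (suc b) zero    e = z≤n , s≤s z≤n
inRange-sound zero    (suc b) (suc t) e = z≤n , s≤s (proj₂ (inRange-sound zero b t e))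
inRange-sound (suc a) (suc b) (suc t) e with a≤t , t<b ← inRange-sound a b t e = s≤s a≤t , s≤s t<b
inRange-sound (suc a) zero    (suc t) e with () ← proj₂ (inRange-sound a zero t e)

inRange-complete : ∀ {a b t} → a ≤ t → t < b → inRange a b t ≡ true
inRange-complete {t = zero}  z≤n       (s≤s _)   = refl
inRange-complete {t = suc t} z≤n       (s≤s t<b) = inRange-complete {t = t} z≤n t<b
inRange-complete             (s≤s a≤t) (s≤s t<b) = inRange-complete a≤t t<b

module RangeSums (R : ℤ-Algebra) (z : ℕ → ℤ-Algebra.Carrier R)
                 (z²≡0 : ∀ t → ℤ-Algebra._⊗_ R (z t) (z t) ≡ ℤ-Algebra.𝟘 R) where
  open ℤ-Algebra R renaming (Carrier to C)
  open Solver R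
  open BigOps R
  open Integral R z z²≡0

  ∑-zero : ∀ n {g : Fin n → C} → (∀ i → g i ≡ 𝟘) → ∑ g ≡ 𝟘
  ∑-zero zero    e = refl
  ∑-zero (suc n) e = trans (cong₂ _⊕_ (e zero) (∑-zero n (e ∘ suc))) (solve 0 (:0 :+ :0 := :0) refl)

  below-zero : ∀ b {g} → (∀ t → g t ≡ 𝟘) → below b g ≡ 𝟘
  below-zero zero    e = refl
  below-zero (suc b) e = trans (cong₂ _⊕_ (e 0) (below-zero b (e ∘ suc))) (solve 0 (:0 :+ :0 := :0) refl)

  -- The left side sees only positions below n, while a and b may lie beyond; the vanishing of g
  -- from n on, which holds for the variables, reconciles the two.
  range-sum : ∀ n (g : ℕ → C) a b → a ≤ b → (∀ t → n ≤ t → g t ≡ 𝟘) →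
    ∑ {n} (λ x → if inRange a b (toℕ x) then g (toℕ x) else 𝟘) ≡ below b g ⊝ below a g
  range-sum zero g a b _ g0 = sym (trans
    (cong₂ _⊝_ (below-zero b (λ t → g0 t z≤n)) (below-zero a (λ t → g0 t z≤n)))
    (solve 0 (:0 :- :0 := :0) refl))
  range-sum (suc n) g zero zero _ g0 = trans (∑-zero (suc n) (λ _ → refl)) (solve 0 (:0 := :0 :- :0) refl)
  range-sum (suc n) g zero (suc b) _ g0 = trans
    (cong (g 0 ⊕_) (range-sum n (g ∘ suc) zero b z≤n (λ t p → g0 (suc t) (s≤s p))))
    (solve 2 (λ a b → a :+ (b :- :0) := a :+ b :- :0) refl _ _)
  range-sum (suc n) g (suc a) (suc b) (s≤s a≤b) g0 = trans
    (cong (𝟘 ⊕_) (range-sum n (g ∘ suc) a b a≤b (λ t p → g0 (suc t) (s≤s p))))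
    (solve 3 (λ a b c → :0 :+ (a :- b) := c :+ a :- (c :+ b)) refl _ _ (g 0))

  point-sum : ∀ n (g : ℕ → C) p → (∀ t → n ≤ t → g t ≡ 𝟘) →
    ∑ {n} (λ x → if toℕ x ≡ᵇ p then g (toℕ x) else 𝟘) ≡ g p
  point-sum zero    g p       g0 = sym (g0 p z≤n)
  point-sum (suc n) g zero    g0 = trans (cong (g 0 ⊕_) (∑-zero n (λ _ → refl))) (solve 1 (λ a → a :+ :0 := a) refl _)
  point-sum (suc n) g (suc p) g0 = trans (cong (𝟘 ⊕_) (point-sum n (g ∘ suc) p (λ t q → g0 (suc t) (s≤s q))))
    (solve 1 (λ a → :0 :+ a := a) refl _)

-- Numbering the vertices of G_X(α)

-- The vertices w grouped by their first index, in step with the recursion of `pairSum`, which makes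
-- `pairSum α` their number.
EdgeVertex : (m : ℕ) → (Fin m → ℕ) → Set
EdgeVertex zero    α = ⊥
EdgeVertex (suc m) α = Σ (Fin m) (λ j → Fin (α zero * α (suc j))) ⊎ EdgeVertex m (α ∘ suc)

sumF-* : ∀ {m} a (b : Fin m → ℕ) → sumF (λ i → a * b i) ≡ a * sumF b
sumF-* {zero}  a b = sym (ℕ.*-zeroʳ a)
sumF-* {suc m} a b = trans (cong (a * b zero +_) (sumF-* a (b ∘ suc))) (sym (ℕ.*-distribˡ-+ a (b zero) _))

Pair : (m : ℕ) → (Fin m → ℕ) → Set
Pair m α = Σ (Fin m) λ i → Σ (Fin m) λ j → toℕ i < toℕ j × Fin (α i * α j)

decode : ∀ {m} α → EdgeVertex m α → Pair m α
decode {suc m} α (inj₁ (j , k)) = zero , suc j , s≤s z≤n , k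
decode {suc m} α (inj₂ x)       = let (i , j , p , k) = decode (α ∘ suc) x in suc i , suc j , s≤s p , k

encode : ∀ {m} α → Pair m α → EdgeVertex m α
encode {suc m} α (zero  , suc j , s≤s z≤n , k) = inj₁ (j , k)
encode {suc m} α (suc i , suc j , s≤s p   , k) = inj₂ (encode (α ∘ suc) (i , j , p , k))

decode-encode : ∀ {m} α x → decode {m} α (encode α x) ≡ x
decode-encode {suc m} α (zero  , suc j , s≤s z≤n , k) = refl
decode-encode {suc m} α (suc i , suc j , s≤s p   , k) =
  cong (λ (i , j , p , k) → suc i , suc j , s≤s p , k) (decode-encode (α ∘ suc) (i , j , p , k))

encode-decode : ∀ {m} α x → encode {m} α (decode α x) ≡ x
encode-decode {suc m} α (inj₁ (j , k)) = refl
encode-decode {suc m} α (inj₂ x)       = cong inj₂ (encode-decode (α ∘ suc) x)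

vertex : ∀ {m α} → Fin m ⊎ EdgeVertex m α → Vert m α
vertex     (inj₁ i) = u i
vertex {α = α} (inj₂ x) = let (i , j , p , k) = decode α x in w i j p k

module _ (R : ℤ-Algebra) where
  open ℤ-Algebra R renaming (Carrier to C)
  open Solver R
  open BigOps R

  -- A numbering of V together with a formula for products over V.
  record Enumeration (V : Set) (M : ℕ) (Π : (V → C) → C) : Set where
    field
      to      : Fin M → V
      from    : V → Fin M
      to-from : ∀ x → to (from x) ≡ x
      from-to : ∀ i → from (to i) ≡ i
      product : ∀ g → ∏ (g ∘ to) ≡ Π g

  open Enumeration

  enum-⊥ : Enumeration ⊥ 0 (λ _ → 𝟙)
  enum-⊥ = record { to = λ () ; from = λ () ; to-from = λ () ; from-to = λ () ; product = λ _ → refl }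

  enum-Fin : ∀ n → Enumeration (Fin n) n ∏
  enum-Fin n = record
    { to = λ i → i ; from = λ i → i ; to-from = λ _ → refl ; from-to = λ _ → refl ; product = λ _ → refl }

  ∏-splitAt : ∀ m {n} (g : Fin m ⊎ Fin n → C) → ∏ (g ∘ splitAt m) ≡ ∏ (g ∘ inj₁) ⊗ ∏ (g ∘ inj₂)
  ∏-splitAt zero    g = solve 1 (λ a → a := :1 :* a) refl _
  ∏-splitAt (suc m) {n} g = trans
    (cong (g (inj₁ zero) ⊗_) (trans (∏-cong {m + n} (λ i → shift (splitAt m i)))
      (∏-splitAt m {n} (g ∘ [ inj₁ ∘ suc , inj₂ ]′))))
    (solve 3 (λ a b c → a :* (b :* c) := a :* b :* c) refl _ _ _)
    where
    shift : ∀ s → g (Sum.map suc (λ j → j) s) ≡ g ([ inj₁ ∘ suc , inj₂ ]′ s)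
    shift (inj₁ _) = refl
    shift (inj₂ _) = refl

  enum-⊎ : ∀ {V W M N ΠV ΠW} → Enumeration V M ΠV → Enumeration W N ΠW →
           Enumeration (V ⊎ W) (M + N) (λ g → ΠV (g ∘ inj₁) ⊗ ΠW (g ∘ inj₂))
  enum-⊎ {M = M} {N} eV eW = record
    { to      = fwd ∘ splitAt M
    ; from    = [ (λ x → from eV x ↑ˡ N) , (λ x → M ↑ʳ from eW x) ]′
    ; to-from = λ
        { (inj₁ x) → trans (cong fwd (Fin.splitAt-↑ˡ M (from eV x) N)) (cong inj₁ (to-from eV x))
        ; (inj₂ x) → trans (cong fwd (Fin.splitAt-↑ʳ M N (from eW x))) (cong inj₂ (to-from eW x)) }
    ; from-to = back
    ; product = λ g → trans (∏-splitAt M (g ∘ fwd)) (cong₂ _⊗_ (product eV (g ∘ inj₁)) (product eW (g ∘ inj₂))) }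
    where
    fwd = [ inj₁ ∘ to eV , inj₂ ∘ to eW ]′
    back : ∀ i → [ (λ x → from eV x ↑ˡ N) , (λ x → M ↑ʳ from eW x) ]′ (fwd (splitAt M i)) ≡ i
    back i with splitAt M i in eq
    ... | inj₁ j = trans (cong (_↑ˡ N) (from-to eV j)) (Fin.splitAt⁻¹-↑ˡ eq)
    ... | inj₂ j = trans (cong (M ↑ʳ_) (from-to eW j)) (Fin.splitAt⁻¹-↑ʳ eq)

  enum-iso : ∀ {V W M ΠV} (φ : V → W) (ψ : W → V) → (∀ x → φ (ψ x) ≡ x) → (∀ x → ψ (φ x) ≡ x) →
             Enumeration V M ΠV → Enumeration W M (λ g → ΠV (g ∘ φ))
  enum-iso φ ψ φψ ψφ e = record
    { to = φ ∘ to e ; from = from e ∘ ψ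
    ; to-from = λ x → trans (cong φ (to-from e (ψ x))) (φψ x)
    ; from-to = λ i → trans (cong (from e) (ψφ (to e i))) (from-to e i)
    ; product = λ g → product e (g ∘ φ) }

  enum-Σ : ∀ n (k : Fin n → ℕ) → Enumeration (Σ (Fin n) (Fin ∘ k)) (sumF k) (λ g → ∏ (λ i → ∏ (λ j → g (i , j))))
  enum-Σ n k = record
    { to = split k ; from = λ (i , j) → join k i j
    ; to-from = λ (i , j) → split-join k i j ; from-to = join-split k
    ; product = ∏-split k }
    where
    ∏-split : ∀ {n} (k : Fin n → ℕ) (g : Σ (Fin n) (Fin ∘ k) → C) →
              ∏ (g ∘ split k) ≡ ∏ (λ i → ∏ (λ j → g (i , j)))
    ∏-split {zero}  k g = refl
    ∏-split {suc n} k g = trans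
      (∏-splitAt (k zero) {sumF (k ∘ suc)}
        (g ∘ [ (λ j → zero , j) , (λ j → let (x , l) = split (k ∘ suc) j in suc x , l) ]′))
      (cong (∏ (λ j → g (zero , j)) ⊗_) (∏-split (k ∘ suc) (λ (x , l) → g (suc x , l))))

  edgeProduct : (m : ℕ) (α : Fin m → ℕ) → (EdgeVertex m α → C) → C
  edgeProduct zero    α g = 𝟙
  edgeProduct (suc m) α g = ∏ (λ j → ∏ (λ k → g (inj₁ (j , k)))) ⊗ edgeProduct m (α ∘ suc) (g ∘ inj₂)

  enum-EdgeVertex : ∀ m α → Enumeration (EdgeVertex m α) (pairSum α) (edgeProduct m α)
  enum-EdgeVertex zero    α = enum-⊥
  enum-EdgeVertex (suc m) α = subst
    (λ M → Enumeration (EdgeVertex (suc m) α) (M + pairSum (α ∘ suc)) (edgeProduct (suc m) α))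
    (sumF-* (α zero) (α ∘ suc))
    (enum-⊎ (enum-Σ m (λ j → α zero * α (suc j))) (enum-EdgeVertex m (α ∘ suc)))

  enum-Vert : ∀ m α → Enumeration (Vert m α) (vcount m α)
                        (λ g → ∏ (g ∘ u) ⊗ edgeProduct m α (λ x → g (vertex (inj₂ x))))
  enum-Vert m α = enum-iso vertex unvertex vu uv (enum-⊎ (enum-Fin m) (enum-EdgeVertex m α))
    where
    unvertex : Vert m α → Fin m ⊎ EdgeVertex m α
    unvertex (u i)       = inj₁ i
    unvertex (w i j p k) = inj₂ (encode α (i , j , p , k))
    vu : ∀ x → vertex (unvertex x) ≡ x
    vu (u i)       = refl
    vu (w i j p k) = cong (λ (i , j , p , k) → w i j p k) (decode-encode α (i , j , p , k))
    uv : ∀ x → unvertex (vertex x) ≡ x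
    uv (inj₁ i) = refl
    uv (inj₂ x) = cong inj₂ (encode-decode α x)

-- Orderings with the positions of all u's prescribed

TopoAt : (m : ℕ) (α P : Fin m → ℕ) → Setoid 0ℓ 0ℓ
TopoAt m α P = topoSetoid {Σ (Topo m α) λ t → ∀ i → toℕ (proj₁ t (u i)) ≡ P i} (λ x → proj₁ (proj₁ x))

module TopoWeight (N : ℕ) where
  open ℤ-Algebra (Squarefree N) renaming (Carrier to C)
  open Solver (Squarefree N)
  open Vandermonde (Squarefree N)
  open Integral (Squarefree N) (var N) (var² N)
  open UpToSign (Squarefree N)
  open BigOps (Squarefree N)

  -- Each factor is the later point minus the earlier one. `Δ` and `discriminant` have the opposite
  -- orientation, which is a source of the signs.
  pairs : List (ℕ × ℕ) → C
  pairs []             = 𝟙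
  pairs ((p , a) ∷ es) = prod (λ (q , b) → (X q ⊝ X p) ^^ (a * b)) es ⊗ pairs es

  topoWeight : List (ℕ × ℕ) → C
  topoWeight es = prod (λ (p , _) → var N p) es ⊗ pairs es

  ∏-tabulate : ∀ {n} {A : Set} (f : A → C) (g : Fin n → A) → ∏ (f ∘ g) ≡ prod f (tabulate g)
  ∏-tabulate {zero}  f g = refl
  ∏-tabulate {suc n} f g = cong (f (g zero) ⊗_) (∏-tabulate f (g ∘ suc))

  ∏-const : ∀ n c → ∏ {n} (λ _ → c) ≡ c ^^ n
  ∏-const zero    c = refl
  ∏-const (suc n) c = cong (c ⊗_) (∏-const n c)

  edgeProduct-pairs : ∀ m (α P : Fin m → ℕ) →
    edgeProduct (Squarefree N) m α
      (λ x → let (i , j , _ , _) = decode α x in X (P j) ⊝ X (P i))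
    ≡ pairs (tabulate (λ i → P i , α i))
  edgeProduct-pairs zero    α P = refl
  edgeProduct-pairs (suc m) α P = cong₂ _⊗_
    (trans (∏-cong {m} (λ j → ∏-const (α zero * α (suc j)) _))
      (∏-tabulate (λ (q , b) → (X q ⊝ X (P zero)) ^^ (α zero * b)) (λ j → P (suc j) , α (suc j))))
    (edgeProduct-pairs m (α ∘ suc) (P ∘ suc))

module _ {m} (α P : Fin m → ℕ) (monotone : ∀ i j → toℕ i < toℕ j → P i ≤ P j) where
  private
    N = vcount m α
    E = enum-Vert (Squarefree N) m α
  open ℤ-Algebra (Squarefree N) renaming (Carrier to C)
  open Solver (Squarefree N)
  open Integral (Squarefree N) (var N) (var² N)
  open RangeSums (Squarefree N) (var N) (var² N)
  open BigOps (Squarefree N)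
  open Bijections N
  open TopoWeight N
  open Enumeration E

  -- Half-open ranges suffice, since an ordering is injective.
  allowed : Vert m α → Fin N → Bool
  allowed (u i)       x = toℕ x ≡ᵇ P i
  allowed (w i j _ _) x = inRange (P i) (P j) (toℕ x)

  allowedSum : Vert m α → C
  allowedSum (u i)       = var N (P i)
  allowedSum (w i j _ _) = X (P j) ⊝ X (P i)

  select-allowed : ∀ x → select (allowed x) ≡ allowedSum x
  select-allowed (u i)       = point-sum N (var N) (P i) (var-beyond N)
  -- Monotone positions make the difference of two sums a sum over an actual range.
  select-allowed (w i j p k) = range-sum N (var N) (P i) (P j) (monotone i j p) (var-beyond N)

  private
    Fillings : Setoid 0ℓ 0ℓ
    Fillings = Completions N (allowed ∘ to) 𝟙

    unit : ∀ x → 𝟙 ⊗ x ≡ x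
    unit x = solve 1 (λ x → :1 :* x := x) refl x

    ordering : Setoid.Carrier Fillings → Setoid.Carrier (TopoAt m α P)
    ordering (f , s , t) = (g , (g-injective , g-surjective) , edges) , at-u
      where
      g : Vert m α → Fin N
      g x = f (from x)
      f-injective : Injective _≡_ _≡_ f
      f-injective = injective-top f (trans (cong (top N) (sym (unit _))) t)
      g-injective : Injective _≡_ _≡_ g
      g-injective {x} {y} e = trans (sym (to-from x)) (trans (cong to (f-injective e)) (to-from y))
      g-surjective : ∀ y → ∃ λ x → ∀ {x′} → x′ ≡ x → g x′ ≡ y
      g-surjective y =
        let π , π≗f = injective⇒permutation f f-injective in
        to (π Perm.⟨$⟩ˡ y) , λ { refl → trans (cong f (from-to _)) (trans (sym (π≗f _)) (Perm.inverseʳ π)) }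
      ok : ∀ x → allowed x (g x) ≡ true
      ok x = subst (λ y → allowed y (g x) ≡ true) (to-from x) (s (from x))
      at-u : ∀ i → toℕ (g (u i)) ≡ P i
      at-u i = ≡ᵇ-sound _ _ (ok (u i))
      strict : ∀ x y → x ≢ y → toℕ (g x) ≤ toℕ (g y) → toℕ (g x) < toℕ (g y)
      strict x y x≢y le = ℕ.≤∧≢⇒< le (λ e → x≢y (g-injective (Fin.toℕ-injective e)))
      edges : ∀ x y → Edge x y → toℕ (g y) < toℕ (g x)
      edges _ _ (uu i j e) = strict (u i) (u j)
        (λ { refl → ℕ.1+n≢n (sym e) })
        (ℕ.≤-trans (ℕ.≤-reflexive (at-u i)) (ℕ.≤-trans (monotone i j (ℕ.≤-reflexive (sym e)))
          (ℕ.≤-reflexive (sym (at-u j)))))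
      edges _ _ (uw i j p k) = ℕ.<-≤-trans (proj₂ (inRange-sound (P i) (P j) (toℕ (g (w i j p k))) (ok (w i j p k))))
        (ℕ.≤-reflexive (sym (at-u j)))
      edges _ _ (wu i j p k) = strict (u i) (w i j p k) (λ ())
        (ℕ.≤-trans (ℕ.≤-reflexive (at-u i)) (proj₁ (inRange-sound (P i) (P j) (toℕ (g (w i j p k))) (ok (w i j p k)))))

    filling : Setoid.Carrier (TopoAt m α P) → Setoid.Carrier Fillings
    filling ((g , (g-injective , _) , edges) , at-u) =
      g ∘ to , (λ i → ok (to i)) , trans (cong (top N) (unit _)) (top-injective (g ∘ to) f-injective)
      where
      f-injective : Injective _≡_ _≡_ (g ∘ to)
      f-injective {i} {j} e = trans (sym (from-to i)) (trans (cong from (g-injective e)) (from-to j))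
      ok : ∀ x → allowed x (g x) ≡ true
      ok (u i)       = subst (λ y → (y ≡ᵇ P i) ≡ true) (sym (at-u i)) (≡ᵇ-refl (P i))
      ok (w i j p k) = inRange-complete
        (ℕ.<⇒≤ (subst (_< toℕ (g (w i j p k))) (at-u i) (edges _ _ (wu i j p k))))
        (subst (toℕ (g (w i j p k)) <_) (at-u j) (edges _ _ (uw i j p k)))

    weight-eq : 𝟙 ⊗ ∏ (λ i → select (allowed (to i))) ≡ topoWeight (tabulate (λ i → P i , α i))
    weight-eq = begin
      𝟙 ⊗ ∏ (λ i → select (allowed (to i)))
        ≡⟨ unit _ ⟩
      ∏ (λ i → select (allowed (to i)))
        ≡⟨ ∏-cong {N} (λ i → select-allowed (to i)) ⟩
      ∏ (allowedSum ∘ to)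
        ≡⟨ product allowedSum ⟩
      ∏ (λ i → var N (P i)) ⊗ edgeProduct (Squarefree N) m α (λ x → allowedSum (vertex (inj₂ x)))
        ≡⟨ cong₂ _⊗_ (∏-tabulate (λ (p , _) → var N p) (λ i → P i , α i)) (edgeProduct-pairs m α P) ⟩
      topoWeight (tabulate (λ i → P i , α i)) ∎

  topoAt-counted′ : ∃ λ k → Counted (TopoAt m α P) k × ℤ.+ k ≡ top N (topoWeight (tabulate (λ i → P i , α i)))
  topoAt-counted′ with k , c , e ← completions N (allowed ∘ to) 𝟙 (monomial-𝟙 N) =
    k , counted-map ordering filling
          (λ e x → e (from x)) (λ e i → e (to i))
          (λ ((g , _) , _) x → cong g (to-from x))
          (λ (f , _) i → cong f (from-to i)) c
      , trans e (cong (top N) weight-eq)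

-- N is given up to an equation, because the two graphs have provably but not definitionally equal
-- numbers of vertices, and both counts must be read in the same ring.
topoAt-counted : ∀ {m} (α P : Fin m → ℕ) → (∀ i j → toℕ i < toℕ j → P i ≤ P j) →
  ∀ {N} → N ≡ vcount m α →
  ∃ λ k → Counted (TopoAt m α P) k × ℤ.+ k ≡ top N (TopoWeight.topoWeight N (tabulate (λ i → P i , α i)))
topoAt-counted α P monotone refl = topoAt-counted′ α P monotone

-- Interleaved positions and the sum over the even ones

-- 2m + 1, in a form whose successor step peels off one odd and one even index.
width : ℕ → ℕ
width zero    = 1
width (suc m) = suc (suc (width m))

odd : ∀ m → Fin (suc m) → Fin (width m)
odd zero    k       = k
odd (suc m) zero    = zero
odd (suc m) (suc k) = suc (suc (odd m k))

even : ∀ m → Fin m → Fin (width m)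
even (suc m) zero    = suc zero
even (suc m) (suc k) = suc (suc (even m k))

toℕ-odd : ∀ m k → toℕ (odd m k) ≡ 2 * toℕ k
toℕ-odd zero    zero    = refl
toℕ-odd (suc m) zero    = refl
toℕ-odd (suc m) (suc k) = trans (cong (2 +_) (toℕ-odd m k)) (sym (ℕ.*-suc 2 (toℕ k)))

toℕ-even : ∀ m k → toℕ (even m k) ≡ suc (2 * toℕ k)
toℕ-even (suc m) zero    = refl
toℕ-even (suc m) (suc k) = trans (cong (2 +_) (toℕ-even m k)) (cong suc (sym (ℕ.*-suc 2 (toℕ k))))

interleave : ∀ {A : Set} m → (Fin (suc m) → A) → (Fin m → A) → Fin (width m) → A
interleave zero    p q k             = p k
interleave (suc m) p q zero          = p zero
interleave (suc m) p q (suc zero)    = q zero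
interleave (suc m) p q (suc (suc i)) = interleave m (p ∘ suc) (q ∘ suc) i

interleave-unique : ∀ {A : Set} m {p : Fin (suc m) → A} {q} (f : Fin (width m) → A) →
  (∀ k → f (odd m k) ≡ p k) → (∀ k → f (even m k) ≡ q k) → ∀ i → f i ≡ interleave m p q i
interleave-unique zero    f fo fe i             = fo i
interleave-unique (suc m) f fo fe zero          = fo zero
interleave-unique (suc m) f fo fe (suc zero)    = fe zero
interleave-unique (suc m) f fo fe (suc (suc i)) =
  interleave-unique m (λ i → f (suc (suc i))) (fo ∘ suc) (fe ∘ suc) i

interleave-odd : ∀ {A : Set} m (p : Fin (suc m) → A) q k → interleave m p q (odd m k) ≡ p k
interleave-odd zero    p q k       = refl
interleave-odd (suc m) p q zero    = refl
interleave-odd (suc m) p q (suc k) = interleave-odd m (p ∘ suc) (q ∘ suc) k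

interleave-even : ∀ {A : Set} m (p : Fin (suc m) → A) q k → interleave m p q (even m k) ≡ q k
interleave-even (suc m) p q zero    = refl
interleave-even (suc m) p q (suc k) = interleave-even m (p ∘ suc) (q ∘ suc) k

-- Half-open like the ranges of `∫`. By `interlaces-complete`, even positions that fail the test
-- admit no ordering.
interlaces : ∀ m → (Fin (suc m) → ℕ) → (Fin m → ℕ) → Bool
interlaces zero    p q = true
interlaces (suc m) p q = inRange (p zero) (p (suc zero)) (q zero) ∧ interlaces m (p ∘ suc) (q ∘ suc)

∧-true : ∀ {a b} → a ∧ b ≡ true → a ≡ true × b ≡ true
∧-true {true} {true} refl = refl , refl

interleave-lower : ∀ m p q → interlaces m p q ≡ true → ∀ i → p zero ≤ interleave m p q i
interleave-lower zero    p q e zero = ℕ.≤-refl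
interleave-lower (suc m) p q e zero = ℕ.≤-refl
interleave-lower (suc m) p q e (suc zero) =
  proj₁ (inRange-sound (p zero) (p (suc zero)) (q zero) (proj₁ (∧-true e)))
interleave-lower (suc m) p q e (suc (suc i)) with p≤q , q<p ← inRange-sound (p zero) (p (suc zero)) (q zero) (proj₁ (∧-true e)) =
  ℕ.≤-trans p≤q (ℕ.≤-trans (ℕ.<⇒≤ q<p) (interleave-lower m (p ∘ suc) (q ∘ suc) (proj₂ (∧-true {inRange (p zero) (p (suc zero)) (q zero)} e)) i))

interleave-monotone : ∀ m p q → interlaces m p q ≡ true →
  ∀ i j → toℕ i < toℕ j → interleave m p q i ≤ interleave m p q j
interleave-monotone zero    p q e zero zero ()
interleave-monotone (suc m) p q e zero j _ = interleave-lower (suc m) p q e j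
interleave-monotone (suc m) p q e (suc zero) (suc zero) (s≤s ())
interleave-monotone (suc m) p q e (suc zero) (suc (suc j)) _ = ℕ.≤-trans
  (ℕ.<⇒≤ (proj₂ (inRange-sound (p zero) (p (suc zero)) (q zero) (proj₁ (∧-true e)))))
  (interleave-lower m (p ∘ suc) (q ∘ suc) (proj₂ (∧-true {inRange (p zero) (p (suc zero)) (q zero)} e)) j)
interleave-monotone (suc m) p q e (suc (suc i)) (suc (suc j)) (s≤s (s≤s i<j)) =
  interleave-monotone m (p ∘ suc) (q ∘ suc) (proj₂ (∧-true {inRange (p zero) (p (suc zero)) (q zero)} e)) i j i<j
interleave-monotone (suc m) p q e (suc (suc i)) (suc zero) (s≤s ())

interlaces-complete : ∀ m p q →
  (∀ i j → toℕ j ≡ suc (toℕ i) → interleave m p q i < interleave m p q j) → interlaces m p q ≡ true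
interlaces-complete zero    p q h = refl
interlaces-complete (suc m) p q h = cong₂ _∧_
  (inRange-complete (ℕ.<⇒≤ (h zero (suc zero) refl))
    (subst (q zero <_) (interleave-odd m (p ∘ suc) (q ∘ suc) zero)
      (h (suc zero) (suc (suc (odd m zero))) (cong (2 +_) (toℕ-odd m zero)))))
  (interlaces-complete m (p ∘ suc) (q ∘ suc) (λ i j e → h (suc (suc i)) (suc (suc j)) (cong (2 +_) e)))

sumFun : ∀ {n} m → ((Fin m → Fin n) → ℕ) → ℕ
sumFun zero    k = k (λ ())
sumFun (suc m) k = sumF (λ x → sumFun m (λ r → k (x Vector.∷ r)))

pointwiseFiber : ∀ {m} {I : Set} (S : Setoid 0ℓ 0ℓ) → (Setoid.Carrier S → Fin m → I) → (Fin m → I) → Setoid 0ℓ 0ℓ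
pointwiseFiber S q r = record
  { Carrier = Σ S.Carrier (λ x → ∀ i → q x i ≡ r i)
  ; _≈_ = λ x y → proj₁ x S.≈ proj₁ y
  ; isEquivalence = record { refl = S.refl ; sym = S.sym ; trans = S.trans } }
  where module S = Setoid S

counted-pointwise-fibers : ∀ {n} m {S : Setoid 0ℓ 0ℓ} (q : Setoid.Carrier S → Fin m → Fin n) →
  (∀ {x y} → Setoid._≈_ S x y → ∀ i → q x i ≡ q y i) → {k : (Fin m → Fin n) → ℕ} →
  (∀ r → Counted (pointwiseFiber S q r) (k r)) → Counted S (sumFun m k)
counted-pointwise-fibers zero {S} q q-cong c = counted-map
  proj₁ (λ x → x , λ ()) (λ e → e) (λ e → e) (λ _ → S.refl) (λ _ → S.refl) (c (λ ()))
  where module S = Setoid S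
counted-pointwise-fibers (suc m) {S} q q-cong c = counted-fibers (λ x → q x zero) (λ e → q-cong e zero) λ i →
  counted-pointwise-fibers m (λ (x , _) k → q x (suc k)) (λ e k → q-cong e (suc k)) λ r →
    counted-map
      (λ (x , e) → (x , e zero) , e ∘ suc)
      (λ ((x , e) , e′) → x , λ { zero → e ; (suc k) → e′ k })
      (λ e → e) (λ e → e) (λ _ → S.refl) (λ _ → S.refl)
      (c (i Vector.∷ r))
  where module S = Setoid S

suc*suc : ∀ a b → suc a * suc b ≡ a * b + suc (a + b)
suc*suc = +-*-Solver.solve 2 (λ a b → (con 1 :+ a) :* (con 1 :+ b) := a :* b :+ (con 1 :+ (a :+ b))) refl
  where open +-*-Solver using (con; _:+_; _:*_; _:=_)

module Interleaving (N : ℕ) where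
  open ℤ-Algebra (Squarefree N) renaming (Carrier to C)
  open Solver (Squarefree N)
  open Vandermonde (Squarefree N)
  open Integral (Squarefree N) (var N) (var² N)
  open RangeSums (Squarefree N) (var N) (var² N)
  open UpToSign (Squarefree N)
  open DixonAnderson (Squarefree N) (var N) (var² N)
  open BigOps (Squarefree N)
  open TopoWeight N

  private
    z : ℕ → C
    z = var N

  ∑Fun : ∀ m → ((Fin m → Fin N) → C) → C
  ∑Fun zero    g = g (λ ())
  ∑Fun (suc m) g = ∑ (λ x → ∑Fun m (λ r → g (x Vector.∷ r)))

  ∑Fun-cong : ∀ m {g h} → (∀ r → g r ≡ h r) → ∑Fun m g ≡ ∑Fun m h
  ∑Fun-cong zero    e = e _
  ∑Fun-cong (suc m) e = ∑-cong {N} (λ x → ∑Fun-cong m (λ r → e (x Vector.∷ r)))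

  ∑Fun-* : ∀ m c g → ∑Fun m (λ r → c ⊗ g r) ≡ c ⊗ ∑Fun m g
  ∑Fun-* zero    c g = refl
  ∑Fun-* (suc m) c g = trans (∑-cong {N} (λ x → ∑Fun-* m c (λ r → g (x Vector.∷ r))))
    (sym (∑-distribˡ {N} c (λ x → ∑Fun m (λ r → g (x Vector.∷ r)))))

  ∑Fun-zero : ∀ m {g} → (∀ r → g r ≡ 𝟘) → ∑Fun m g ≡ 𝟘
  ∑Fun-zero zero    e = e _
  ∑Fun-zero (suc m) e = ∑-zero N (λ x → ∑Fun-zero m (λ r → e (x Vector.∷ r)))

  +-sumFun : ∀ m (k : (Fin m → Fin N) → ℕ) (g : (Fin m → Fin N) → C) →
             (∀ r → ℤ.+ k r ≡ top N (g r)) → ℤ.+ sumFun m k ≡ top N (∑Fun m g)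
  +-sumFun zero    k g e = e _
  +-sumFun (suc m) k g e = Bijections.+-sumF N _ _ (λ x → +-sumFun m _ _ (λ r → e (x Vector.∷ r)))

  positions : ∀ {m} → (Fin m → Fin N) → List ℕ
  positions r = tabulate (toℕ ∘ r)

  nodesAt : ∀ {m} → (Fin m → ℕ) → (Fin m → ℕ) → List Node
  nodesAt p a = tabulate (λ k → p k , a k)

  -- Each even position contributes its variable as the measure and its point `X` as the argument;
  -- since consecutive values of p do not decrease, the sum over its range is the integral over the
  -- gap.
  ∑Fun-∫∫ : ∀ m (p a : Fin (suc m) → ℕ) → (∀ k → p (inject₁ k) ≤ p (suc k)) → ∀ F →
    ∑Fun m (λ r → if interlaces m p (toℕ ∘ r) then prod z (positions r) ⊗ F (map X (positions r)) else 𝟘)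
      ≡ ∫∫ (gaps (nodesAt p a)) F
  ∑Fun-∫∫ zero    p a p≤ F = solve 1 (λ f → :1 :* f := f) refl (F [])
  ∑Fun-∫∫ (suc m) p a p≤ F = trans (∑-cong {N} at)
    (range-sum N (λ t → z t ⊗ G (X t)) (p zero) (p (suc zero)) (p≤ zero)
      (λ t le → trans (cong (_⊗ G (X t)) (var-beyond N t le)) (solve 1 (λ g → :0 :* g := :0) refl _)))
    where
    G : C → C
    G x = ∫∫ (gaps (nodesAt (p ∘ suc) (a ∘ suc))) (λ xs → F (x ∷ xs))
    at : ∀ x → ∑Fun m (λ r →
        if inRange (p zero) (p (suc zero)) (toℕ x) ∧ interlaces m (p ∘ suc) (toℕ ∘ r)
        then z (toℕ x) ⊗ prod z (positions r) ⊗ F (X (toℕ x) ∷ map X (positions r)) else 𝟘)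
      ≡ (if inRange (p zero) (p (suc zero)) (toℕ x) then z (toℕ x) ⊗ G (X (toℕ x)) else 𝟘)
    at x with inRange (p zero) (p (suc zero)) (toℕ x)
    ... | false = ∑Fun-zero m (λ _ → refl)
    ... | true  = trans (∑Fun-cong m pull) (trans (∑Fun-* m (z (toℕ x)) _)
        (cong (z (toℕ x) ⊗_)
          (∑Fun-∫∫ m (p ∘ suc) (a ∘ suc) (p≤ ∘ suc) (λ xs → F (X (toℕ x) ∷ xs)))))
      where
      pull : ∀ r → (if interlaces m (p ∘ suc) (toℕ ∘ r)
                    then z (toℕ x) ⊗ prod z (positions r) ⊗ F (X (toℕ x) ∷ map X (positions r)) else 𝟘)
                 ≡ z (toℕ x) ⊗ (if interlaces m (p ∘ suc) (toℕ ∘ r)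
                    then prod z (positions r) ⊗ F (X (toℕ x) ∷ map X (positions r)) else 𝟘)
      pull r with interlaces m (p ∘ suc) (toℕ ∘ r)
      ... | true  = solve 3 (λ a b c → a :* b :* c := a :* (b :* c)) refl _ _ _
      ... | false = solve 1 (λ a → :0 := a :* :0) refl _

  -- The node list e, (r₁ , 1), e₁, (r₂ , 1), e₂, …
  weave : Node → List (ℕ × Node) → List Node
  weave e []              = e ∷ []
  weave e ((r , e′) ∷ es) = e ∷ (r , 1) ∷ weave e′ es

  prod-weave : ∀ f e es → prod f (weave e es) ≡ prod f (e ∷ map proj₂ es) ⊗ prod (λ (r , _) → f (r , 1)) es
  prod-weave f e []              = solve 1 (λ a → a := a :* :1) refl _
  prod-weave f e ((r , e′) ∷ es) = trans (cong (λ y → f e ⊗ (f (r , 1) ⊗ y)) (prod-weave f e′ es))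
    (solve 5 (λ a b c d g → a :* (b :* (c :* d :* g)) := a :* (c :* d) :* (b :* g)) refl _ _ _ _ _)

  prod-map : {A B : Set} (f : B → C) (g : A → B) → ∀ xs → prod f (map g xs) ≡ prod (f ∘ g) xs
  prod-map f g []       = refl
  prod-map f g (x ∷ xs) = cong (f (g x) ⊗_) (prod-map f g xs)

  crossSign : List Node → C
  crossSign ns = prod (λ (_ , b) → -1^ b) ns

  -- Here n is the odd node right after an even point r: `crossSign` reverses r against all later
  -- odd nodes, the power of -1 against the `length ns` later even points. Only exponents and
  -- lengths enter, so the sign is the same for all even positions and can leave the sum.
  weaveSign : List Node → C
  weaveSign []       = 𝟙
  weaveSign (n ∷ ns) = crossSign (n ∷ ns) ⊗ -1^ length ns ⊗ weaveSign ns

  crossSign~1 : ∀ ns → crossSign ns ~ 𝟙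
  crossSign~1 []             = inj₁ refl
  crossSign~1 ((_ , b) ∷ ns) = ~-trans (~-⊗ (-1^n~1 b) (crossSign~1 ns)) (inj₁ (solve 0 (:1 :* :1 := :1) refl))

  weaveSign~1 : ∀ ns → weaveSign ns ~ 𝟙
  weaveSign~1 []       = inj₁ refl
  weaveSign~1 (n ∷ ns) = ~-trans (~-⊗ (~-⊗ (crossSign~1 (n ∷ ns)) (-1^n~1 (length ns))) (weaveSign~1 ns))
    (inj₁ (solve 0 (:1 :* :1 :* :1 := :1) refl))

  -- Two odd nodes give a factor of `pairs`; an odd node and an even point, with exponent α · 1,
  -- give a factor of the weight; two even points, with exponent 1 · 1, give a factor of `Δ`.
  pairs-weave : ∀ e es → pairs (weave e es)
    ≡ weaveSign (map proj₂ es) ⊗ (pairs (e ∷ map proj₂ es)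
        ⊗ (prod (weight (e ∷ map proj₂ es)) (map (X ∘ proj₁) es) ⊗ Δ (map (X ∘ proj₁) es)))
  pairs-weave e [] = solve 1 (λ a → a := :1 :* (a :* (:1 :* :1))) refl _
  pairs-weave e@(p , a) ((r , e′) ∷ es) = begin
    row e ((r , 1) ∷ I) ⊗ (row (r , 1) I ⊗ pairs I)
      ≡⟨ cong₂ _⊗_
           (cong₂ _⊗_ (cong ((X r ⊝ X p) ^^_) (ℕ.*-identityʳ a)) (trans (prod-weave _ e′ es)
             (cong (row e ns ⊗_) (prod-cong (λ (s , _) → cong ((X s ⊝ X p) ^^_) (ℕ.*-identityʳ a)) es))))
           (cong₂ _⊗_ (trans (prod-weave _ e′ es) (cong₂ _⊗_ (flipRow ns) (flipΔ es))) (pairs-weave e′ es)) ⟩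
    (X r ⊝ X p) ^^ a ⊗ (row e ns ⊗ pe)
      ⊗ (crossSign ns ⊗ weight ns (X r) ⊗ (-1^ length es ⊗ dr)
        ⊗ (weaveSign (map proj₂ es) ⊗ (pairs ns ⊗ (wn ⊗ Δ xs))))
      ≡⟨ rearrange _ _ _ _ _ _ _ _ _ _ _ ⟩
    crossSign ns ⊗ -1^ length es ⊗ weaveSign (map proj₂ es)
      ⊗ (row e ns ⊗ pairs ns ⊗ ((X r ⊝ X p) ^^ a ⊗ weight ns (X r) ⊗ (pe ⊗ wn) ⊗ (dr ⊗ Δ xs)))
      ≡⟨ cong₂ (λ l W → crossSign ns ⊗ -1^ l ⊗ weaveSign (map proj₂ es)
                  ⊗ (row e ns ⊗ pairs ns ⊗ ((X r ⊝ X p) ^^ a ⊗ weight ns (X r) ⊗ W ⊗ (dr ⊗ Δ xs))))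
           (sym (List.length-map proj₂ es)) weights ⟩
    crossSign ns ⊗ -1^ length (map proj₂ es) ⊗ weaveSign (map proj₂ es)
      ⊗ (row e ns ⊗ pairs ns ⊗ (prod (weight (e ∷ ns)) (X r ∷ xs) ⊗ (dr ⊗ Δ xs))) ∎
    where
    row : Node → List Node → C
    row (p , a) = prod (λ (q , b) → (X q ⊝ X p) ^^ (a * b))
    I = weave e′ es
    ns = e′ ∷ map proj₂ es
    xs = map (X ∘ proj₁) es
    pe = prod (λ (s , _) → (X s ⊝ X p) ^^ a) es
    dr = prod (X r ⊝_) xs
    wn = prod (weight ns) xs
    weights : pe ⊗ wn ≡ prod (weight (e ∷ ns)) xs
    weights = begin
      pe ⊗ wn
        ≡⟨ cong (_⊗ wn) (prod-map (λ x → (x ⊝ X p) ^^ a) (X ∘ proj₁) es) ⟨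
      prod (λ x → (x ⊝ X p) ^^ a) xs ⊗ wn
        ≡⟨ prod-⊗ (λ x → (x ⊝ X p) ^^ a) (weight ns) xs ⟨
      prod (weight (e ∷ ns)) xs ∎
    flipRow : ∀ ns → prod (λ (q , b) → (X q ⊝ X r) ^^ (1 * b)) ns ≡ crossSign ns ⊗ weight ns (X r)
    flipRow ns = trans
      (prod-cong (λ (q , b) → trans (cong ((X q ⊝ X r) ^^_) (ℕ.*-identityˡ b)) (⊝-swap-^^ (X q) (X r) b)) ns)
      (prod-⊗ (λ (q , b) → -1^ b) (λ (q , b) → (X r ⊝ X q) ^^ b) ns)
    flipΔ : ∀ es → prod (λ (s , _) → (X s ⊝ X r) ^^ (1 * 1)) es ≡ -1^ length es ⊗ prod (X r ⊝_) (map (X ∘ proj₁) es)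
    flipΔ []             = solve 0 (:1 := :1 :* :1) refl
    flipΔ ((s , _) ∷ es) = trans (cong ((X s ⊝ X r) ⊗ 𝟙 ⊗_) (flipΔ es))
      (solve 4 (λ x y s p → (x :- y) :* :1 :* (s :* p) := (:- :1) :* s :* ((y :- x) :* p)) refl (X s) (X r) _ _)
    rearrange : ∀ a b c d e f g h i j k →
      a ⊗ (b ⊗ c) ⊗ (d ⊗ e ⊗ (f ⊗ g) ⊗ (h ⊗ (i ⊗ (j ⊗ k))))
        ≡ d ⊗ f ⊗ h ⊗ (b ⊗ i ⊗ (a ⊗ e ⊗ (c ⊗ j) ⊗ (g ⊗ k)))
    rearrange = solve 11 (λ a b c d e f g h i j k →
      a :* (b :* c) :* (d :* e :* (f :* g) :* (h :* (i :* (j :* k))))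
        := d :* f :* h :* (b :* i :* (a :* e :* (c :* j) :* (g :* k)))) refl

  tabulate-weave : ∀ m (α : Fin (width m) → ℕ) (p : Fin (suc m) → ℕ) (q : Fin m → ℕ) →
    (∀ k → α (even m k) ≡ 1) →
    tabulate (λ i → interleave m p q i , α i)
      ≡ weave (p zero , α (odd m zero)) (tabulate (λ k → q k , (p (suc k) , α (odd m (suc k)))))
  tabulate-weave zero    α p q α≡1 = refl
  tabulate-weave (suc m) α p q α≡1 = cong₂ (λ a es → (p zero , α zero) ∷ (q zero , a) ∷ es)
    (α≡1 zero) (tabulate-weave m (λ i → α (suc (suc i))) (p ∘ suc) (q ∘ suc) (α≡1 ∘ suc))

  -- The discriminant is absorbed here: its exponents are what `pairs` lacks when every exponent
  -- grows by one.
  pairs-raise : ∀ ns → pairs (map (λ (p , a) → p , suc a) ns) ~ pairs ns ⊗ discriminant ns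
  pairs-raise []             = inj₁ (solve 0 (:1 := :1 :* :1) refl)
  pairs-raise ((p , a) ∷ ns) = ~-trans (~-⊗ (row ns) (pairs-raise ns))
    (inj₁ (solve 4 (λ a b c d → a :* b :* (c :* d) := a :* c :* (b :* d)) refl _ _ _ _))
    where
    row : ∀ ns → prod (λ (q , b) → (X q ⊝ X p) ^^ (suc a * b)) (map (λ (p , a) → p , suc a) ns)
               ~ prod (λ (q , b) → (X q ⊝ X p) ^^ (a * b)) ns ⊗ prod (λ (q , b) → (X p ⊝ X q) ^^ suc (a + b)) ns
    row []             = inj₁ (solve 0 (:1 := :1 :* :1) refl)
    row ((q , b) ∷ ns) = ~-trans (~-⊗ factor (row ns))
      (inj₁ (solve 4 (λ a b c d → a :* b :* (c :* d) := a :* c :* (b :* d)) refl _ _ _ _))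
      where
      factor : (X q ⊝ X p) ^^ (suc a * suc b) ~ (X q ⊝ X p) ^^ (a * b) ⊗ (X p ⊝ X q) ^^ suc (a + b)
      factor = ~-trans
        (inj₁ (trans (cong ((X q ⊝ X p) ^^_) (suc*suc a b)) (trans (^^-+ (X q ⊝ X p) (a * b) (suc (a + b)))
          (cong ((X q ⊝ X p) ^^ (a * b) ⊗_) (⊝-swap-^^ (X q) (X p) (suc (a + b)))))))
        (~-⊗ {x = (X q ⊝ X p) ^^ (a * b)} (inj₁ refl) (~-trans
          (~-⊗ {c = (X p ⊝ X q) ^^ suc (a + b)} (-1^n~1 (suc (a + b))) (inj₁ refl))
          (inj₁ (solve 1 (λ x → :1 :* x := x) refl _))))

  -- The order adds 1 for each of the m + 1 odd indices, and `sumF α` contains the m even exponents,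
  -- all equal to 1; hence the difference 1.
  order-sumF : ∀ m (α : Fin (width m) → ℕ) (p : Fin (suc m) → ℕ) → (∀ k → α (even m k) ≡ 1) →
    order (nodesAt p (α ∘ odd m)) ≡ suc (sumF α)
  order-sumF zero    α p α≡1 = refl
  order-sumF (suc m) α p α≡1 = cong suc (cong (α zero +_)
    (trans (order-sumF m (λ i → α (suc (suc i))) (p ∘ suc) (α≡1 ∘ suc))
      (cong (_+ sumF (λ i → α (suc (suc i)))) (sym (α≡1 zero)))))

  factorials-prodF : ∀ m (α : Fin (width m) → ℕ) (p : Fin (suc m) → ℕ) → (∀ k → α (even m k) ≡ 1) →
    factorials (nodesAt p (α ∘ odd m)) ≡ prodF (λ i → α i !)
  factorials-prodF zero    α p α≡1 = refl
  factorials-prodF (suc m) α p α≡1 = cong (α zero ! *_)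
    (trans (factorials-prodF m (λ i → α (suc (suc i))) (p ∘ suc) (α≡1 ∘ suc))
      (trans (sym (ℕ.*-identityˡ _)) (cong (λ a → a ! * prodF (λ i → α (suc (suc i)) !)) (sym (α≡1 zero)))))

sumF-cong : ∀ {m} {a b : Fin m → ℕ} → (∀ i → a i ≡ b i) → sumF a ≡ sumF b
sumF-cong {zero}  e = refl
sumF-cong {suc m} e = cong₂ _+_ (e zero) (sumF-cong (e ∘ suc))

pairSum-cong : ∀ {m} {a b : Fin m → ℕ} → (∀ i → a i ≡ b i) → pairSum a ≡ pairSum b
pairSum-cong {zero}  e = refl
pairSum-cong {suc m} e = cong₂ _+_ (cong₂ _*_ (e zero) (sumF-cong (e ∘ suc))) (pairSum-cong (e ∘ suc))

sumF-odd : ∀ m (α : Fin (width m) → ℕ) → (∀ k → α (even m k) ≡ 1) →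
  sumF (λ k → suc (α (odd m k))) ≡ suc (sumF α)
sumF-odd zero    α α≡1 = refl
sumF-odd (suc m) α α≡1 = cong suc (cong (α zero +_)
  (trans (sumF-odd m (λ i → α (suc (suc i))) (α≡1 ∘ suc))
    (cong (_+ sumF (λ i → α (suc (suc i)))) (sym (α≡1 zero)))))

vcount-odd : ∀ m (α : Fin (width m) → ℕ) → (∀ k → α (even m k) ≡ 1) →
  vcount (suc m) (λ k → suc (α (odd m k))) ≡ vcount (width m) α
vcount-odd zero    α α≡1 = cong suc (cong (_+ 0) (trans (ℕ.*-zeroʳ (suc (α zero))) (sym (ℕ.*-zeroʳ (α zero)))))
vcount-odd (suc m) α α≡1 = begin
  suc (suc m + (suc a * sumF (λ k → suc (β (odd m k))) + pairSum (λ k → suc (β (odd m k)))))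
    ≡⟨ cong (λ s → suc (suc m + (suc a * s + pairSum (λ k → suc (β (odd m k)))))) (sumF-odd m β (α≡1 ∘ suc)) ⟩
  suc (suc m + (suc a * suc s + pairSum (λ k → suc (β (odd m k)))))
    -- For B the first index has one u and (a + 1)(1 + s) vertices w; for A the first odd and the
    -- first even index together have two u's and a (1 + s) + 1 · s vertices w, each w being
    -- assigned to its smaller index.
    ≡⟨ +-*-Solver.solve 4 (λ m a s q →
         con 1 :+ ((con 1 :+ m) :+ ((con 1 :+ a) :* (con 1 :+ s) :+ q))
           := con 2 :+ (((con 1 :+ m) :+ q) :+ (a :* (con 1 :+ s) :+ con 1 :* s)))
         refl m a s (pairSum (λ k → suc (β (odd m k)))) ⟩
  2 + (vcount (suc m) (λ k → suc (β (odd m k))) + (a * (1 + s) + 1 * s))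
    ≡⟨ cong (λ v → 2 + (v + (a * (1 + s) + 1 * s))) (vcount-odd m β (α≡1 ∘ suc)) ⟩
  2 + (width m + pairSum β + (a * (1 + s) + 1 * s))
    ≡⟨ cong (λ b → 2 + (width m + pairSum β + (a * (b + s) + b * s))) (α≡1 zero) ⟨
  2 + (width m + pairSum β + (a * (b + s) + b * s))
    ≡⟨ +-*-Solver.solve 4 (λ w q x y → con 2 :+ (w :+ q :+ (x :+ y)) := con 2 :+ (w :+ (x :+ (y :+ q))))
         refl (width m) (pairSum β) (a * (b + s)) (b * s) ⟩
  2 + (width m + (a * (b + s) + (b * s + pairSum β))) ∎
  where
  open +-*-Solver using (con; _:+_; _:*_; _:=_)
  a = α zero
  b = α (suc zero)
  β : Fin (width m) → ℕ
  β i = α (suc (suc i))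
  s = sumF β

steps⇒monotone : ∀ {m} (p : Fin (suc m) → ℕ) → (∀ k → p (inject₁ k) ≤ p (suc k)) →
                 ∀ i j → toℕ i < toℕ j → p i ≤ p j
steps⇒monotone {m}     p p≤ zero    j       _         = least m p p≤ j
  where
  least : ∀ m (p : Fin (suc m) → ℕ) → (∀ k → p (inject₁ k) ≤ p (suc k)) → ∀ j → p zero ≤ p j
  least m       p p≤ zero    = ℕ.≤-refl
  least (suc m) p p≤ (suc j) = ℕ.≤-trans (p≤ zero) (least m (p ∘ suc) (p≤ ∘ suc) j)
steps⇒monotone {suc m} p p≤ (suc i) (suc j) (s≤s i<j) = steps⇒monotone (p ∘ suc) (p≤ ∘ suc) i j i<j

-- Comparison of the two counts

module Comparison (m : ℕ) (α : Fin (width m) → ℕ) (α≡1 : ∀ k → α (even m k) ≡ 1)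
                  (o : Fin (suc m) → Fin (width m)) (o≗odd : ∀ k → o k ≡ odd m k)
                  (p : Fin (suc m) → ℕ) where
  private
    N = vcount (width m) α
  open ℤ-Algebra (Squarefree N) renaming (Carrier to C)
  open Solver (Squarefree N)
  open Vandermonde (Squarefree N)
  open Integral (Squarefree N) (var N) (var² N)
  open UpToSign (Squarefree N)
  open DixonAnderson (Squarefree N) (var N) (var² N)
  open TopoWeight N
  open Interleaving N

  -- Both are phrased with `o`, which becomes the index map of the statement; that map is built from
  -- inequality proofs and is known to agree with `odd m` only pointwise.
  A B : Setoid 0ℓ 0ℓ
  A = topoSetoid {Σ (Topo (width m) α) λ t → ∀ k → toℕ (proj₁ t (u (o k))) ≡ p k} (λ x → proj₁ (proj₁ x))
  B = TopoAt (suc m) (λ k → suc (α (o k))) p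

  nodes : List Node
  nodes = nodesAt p (α ∘ odd m)

  -- The part of the weight of an ordering in A that does not involve the even u's.
  frame : C
  frame = prod (λ (q , _) → var N q) nodes ⊗ pairs nodes

  sign : C
  sign = weaveSign (tabulate (λ k → p (suc k) , α (odd m (suc k))))

  integrand : List C → C
  integrand xs = prod (weight nodes) xs ⊗ Δ xs

  topoWeight-interleave : ∀ r → topoWeight (tabulate (λ i → interleave m p (toℕ ∘ r) i , α i))
    ≡ sign ⊗ frame ⊗ (prod (var N) (positions r) ⊗ integrand (map X (positions r)))
  topoWeight-interleave r = begin
    topoWeight (tabulate (λ i → interleave m p (toℕ ∘ r) i , α i))
      ≡⟨ cong topoWeight (tabulate-weave m α p (toℕ ∘ r) α≡1) ⟩
    topoWeight (weave e es)
      ≡⟨ cong₂ _⊗_ (prod-weave (λ (q , _) → var N q) e es) (pairs-weave e es) ⟩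
    Z (e ∷ map proj₂ es) ⊗ prod (λ (q , _) → var N q) es
      ⊗ (weaveSign (map proj₂ es) ⊗ (pairs (e ∷ map proj₂ es)
        ⊗ (prod (weight (e ∷ map proj₂ es)) (map (X ∘ proj₁) es) ⊗ Δ (map (X ∘ proj₁) es))))
      ≡⟨ cong (λ ns → Z (e ∷ ns) ⊗ prod (λ (q , _) → var N q) es ⊗ (weaveSign ns ⊗ (pairs (e ∷ ns)
             ⊗ (prod (weight (e ∷ ns)) (map (X ∘ proj₁) es) ⊗ Δ (map (X ∘ proj₁) es)))))
           (List.map-tabulate entry proj₂) ⟩
    Z nodes ⊗ prod (λ (q , _) → var N q) es ⊗ (sign ⊗ (pairs nodes ⊗ integrand (map (X ∘ proj₁) es)))
      ≡⟨ cong₂ (λ v xs → Z nodes ⊗ v ⊗ (sign ⊗ (pairs nodes ⊗ integrand xs)))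
           (trans (sym (prod-map (var N) proj₁ es)) (cong (prod (var N)) (List.map-tabulate entry proj₁)))
           (trans (List.map-tabulate entry (X ∘ proj₁)) (sym (List.map-tabulate (toℕ ∘ r) X))) ⟩
    Z nodes ⊗ prod (var N) (positions r) ⊗ (sign ⊗ (pairs nodes ⊗ integrand (map X (positions r))))
      ≡⟨ solve 5 (λ a b c d f → a :* b :* (c :* (d :* f)) := c :* (a :* d) :* (b :* f)) refl _ _ _ _ _ ⟩
    sign ⊗ frame ⊗ (prod (var N) (positions r) ⊗ integrand (map X (positions r))) ∎
    where
    Z : List Node → C
    Z = prod (λ (q , _) → var N q)
    e : Node
    e = p zero , α (odd m zero)
    entry : Fin m → ℕ × Node
    entry k = toℕ (r k) , (p (suc k) , α (odd m (suc k)))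
    es : List (ℕ × Node)
    es = tabulate entry

  evens : Setoid.Carrier A → Fin m → Fin N
  evens ((f , _) , _) k = f (u (even m k))

  at-odd : ((t , _) : Setoid.Carrier A) → ∀ k → toℕ (proj₁ t (u (odd m k))) ≡ p k
  at-odd (t , po) k = trans (cong (λ i → toℕ (proj₁ t (u i))) (sym (o≗odd k))) (po k)

  A-interleaved : ∀ r (x : Setoid.Carrier (pointwiseFiber A evens r)) i →
    toℕ (proj₁ (proj₁ (proj₁ x)) (u i)) ≡ interleave m p (toℕ ∘ r) i
  A-interleaved r (x , pe) = interleave-unique m _ (at-odd x) (λ k → cong toℕ (pe k))

  -- Two edges of the path of the u's join consecutive odd indices, so a single ordering in A
  -- already forces the prescribed positions to increase.
  A-steps : Setoid.Carrier A → ∀ k → p (inject₁ k) ≤ p (suc k)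
  A-steps x@((f , _ , edges) , _) k = subst₂ _≤_ (at-odd x (inject₁ k)) (at-odd x (suc k))
    (ℕ.<⇒≤ (ℕ.<-trans
      (edges _ _ (uu (odd m (inject₁ k)) (even m k)
        (trans (toℕ-even m k) (cong suc (trans (cong (2 *_) (sym (Fin.toℕ-inject₁ k))) (sym (toℕ-odd m (inject₁ k))))))))
      (edges _ _ (uu (even m k) (odd m (suc k))
        (trans (toℕ-odd m (suc k)) (trans (ℕ.*-suc 2 (toℕ k)) (cong suc (sym (toℕ-even m k)))))))))

  B-size : N ≡ vcount (suc m) (λ k → suc (α (o k)))
  B-size = trans (sym (vcount-odd m α α≡1))
    (cong (suc m +_) (pairSum-cong (λ k → cong (λ i → suc (α i)) (sym (o≗odd k)))))

  B-steps : Setoid.Carrier B → ∀ k → p (inject₁ k) ≤ p (suc k)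
  B-steps ((f , _ , edges) , pos) k = subst₂ _≤_ (pos (inject₁ k)) (pos (suc k))
    (ℕ.<⇒≤ (edges _ _ (uu (inject₁ k) (suc k) (cong suc (sym (Fin.toℕ-inject₁ k))))))

  module _ (p≤ : ∀ k → p (inject₁ k) ≤ p (suc k)) where

    -- A is cut into fibers over the positions of the even u's. A fiber prescribes all u's, so its
    -- size is the top coefficient of a `topoWeight`, or 0 if the positions do not interlace.
    A-counted : ∃ λ k → Counted A k × ℤ.+ k ≡ top N (sign ⊗ frame ⊗ andersonIntegral nodes)
    A-counted = sumFun m (λ r → proj₁ (at r))
      , counted-pointwise-fibers m evens (λ e k → e (u (even m k))) (λ r → proj₁ (proj₂ (at r)))
      , trans (+-sumFun m _ _ (λ r → proj₂ (proj₂ (at r)))) (cong (top N) (begin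
          ∑Fun m (λ r → if interlaces m p (toℕ ∘ r)
                        then topoWeight (tabulate (λ i → interleave m p (toℕ ∘ r) i , α i)) else 𝟘)
            ≡⟨ ∑Fun-cong m pull ⟩
          ∑Fun m (λ r → sign ⊗ frame ⊗ (if interlaces m p (toℕ ∘ r)
                        then prod (var N) (positions r) ⊗ integrand (map X (positions r)) else 𝟘))
            ≡⟨ ∑Fun-* m (sign ⊗ frame) _ ⟩
          sign ⊗ frame ⊗ ∑Fun m (λ r → if interlaces m p (toℕ ∘ r)
                        then prod (var N) (positions r) ⊗ integrand (map X (positions r)) else 𝟘)
            ≡⟨ cong (sign ⊗ frame ⊗_) (∑Fun-∫∫ m p (α ∘ odd m) p≤ integrand) ⟩
          sign ⊗ frame ⊗ andersonIntegral nodes ∎))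
      where
      pull : ∀ r → (if interlaces m p (toℕ ∘ r)
                    then topoWeight (tabulate (λ i → interleave m p (toℕ ∘ r) i , α i)) else 𝟘)
        ≡ sign ⊗ frame ⊗ (if interlaces m p (toℕ ∘ r)
                    then prod (var N) (positions r) ⊗ integrand (map X (positions r)) else 𝟘)
      pull r with interlaces m p (toℕ ∘ r)
      ... | true  = topoWeight-interleave r
      ... | false = solve 1 (λ a → :0 := a :* :0) refl _

      at : ∀ r → ∃ λ k → Counted (pointwiseFiber A evens r) k × ℤ.+ k ≡
        top N (if interlaces m p (toℕ ∘ r) then topoWeight (tabulate (λ i → interleave m p (toℕ ∘ r) i , α i)) else 𝟘)
      at r with interlaces m p (toℕ ∘ r) in eq
      ... | true with k , c , e ← topoAt-counted α (interleave m p (toℕ ∘ r)) (interleave-monotone m p (toℕ ∘ r) eq) refl =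
        k , counted-map
              (λ (t , pos) → (t , (λ k → trans (cong (λ i → toℕ (proj₁ t (u i))) (o≗odd k))
                                 (trans (pos (odd m k)) (interleave-odd m p (toℕ ∘ r) k))))
                             , (λ k → Fin.toℕ-injective (trans (pos (even m k)) (interleave-even m p (toℕ ∘ r) k))))
              (λ x → proj₁ (proj₁ x) , A-interleaved r x)
              (λ e → e) (λ e → e) (λ _ _ → refl) (λ _ _ → refl) c
          , e
      ... | false = 0 , counted-empty none , sym (top-𝟘 N)
        where
        none : Setoid.Carrier (pointwiseFiber A evens r) → ⊥
        none x@(((f , _ , edges) , _) , _) with () ← trans (sym eq) (interlaces-complete m p (toℕ ∘ r)
          (λ i j e → subst₂ _<_ (A-interleaved r x i) (A-interleaved r x j) (edges _ _ (uu i j e))))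

    B-counted : ∃ λ k → Counted B k × ℤ.+ k ≡ top N (topoWeight (map (λ (q , a) → q , suc a) nodes))
    B-counted with k , c , e ← topoAt-counted (λ k → suc (α (o k))) p (steps⇒monotone p p≤) B-size =
      k , c , trans e (cong (top N ∘ topoWeight) (trans
        (List.tabulate-cong (λ k → cong (λ i → p k , suc (α i)) (o≗odd k)))
        (sym (List.map-tabulate (λ k → p k , α (odd m k)) (λ (q , a) → q , suc a)))))

    -- The factorials come from `evaluation`, whose discriminant merges with the pairs in `frame`
    -- into the pairs of B.
    weights-agree : fromℕ (sumF α !) ⊗ (sign ⊗ frame ⊗ andersonIntegral nodes)
      ~ fromℕ (prodF (λ i → α i !)) ⊗ topoWeight (map (λ (q , a) → q , suc a) nodes)
    weights-agree = ~-trans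
      (inj₁ (trans (cong (λ n → fromℕ (n !) ⊗ (sign ⊗ frame ⊗ andersonIntegral nodes)) (cong pred (sym (order-sumF m α p α≡1))))
        (solve 4 (λ a b c d → a :* (b :* c :* d) := b :* c :* (a :* d)) refl _ _ _ _))) (~-trans
      (~-⊗ (~-⊗ {c = frame} (weaveSign~1 (tabulate (λ k → p (suc k) , α (odd m (suc k))))) (inj₁ refl)) (evaluation nodes)) (~-trans
      (inj₁ (solve 4 (λ z v f d → :1 :* (z :* v) :* (f :* d) := f :* (z :* (v :* d))) refl _ _ _ _)) (~-⊗
      (inj₁ (cong fromℕ (factorials-prodF m α p α≡1)))
      (~-⊗ (inj₁ (sym (prod-map (λ (q , _) → var N q) (λ (q , a) → q , suc a) nodes))) (~-sym (pairs-raise nodes))))))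

    counts-agree : sumF α ! * proj₁ A-counted ≡ prodF (λ i → α i !) * proj₁ B-counted
    counts-agree = compare (top-~ weights-agree)
      where
      top-~ : ∀ {x y} → x ~ y → top N x ≡ top N y ⊎ top N x ≡ ℤ.- top N y
      top-~ (inj₁ refl) = inj₁ refl
      top-~ (inj₂ refl) = inj₂ (top-⊖ N _)
      lift : ∀ a k x → ℤ.+ k ≡ top N x → ℤ.+ (a * k) ≡ top N (fromℕ a ⊗ x)
      lift a k x e = trans (ℤ.pos-* a k) (trans (cong (ℤ.+ a ℤ.*_) e) (sym (top-ι N (ℤ.+ a) x)))
      lhs = lift (sumF α !) (proj₁ A-counted) _ (proj₂ (proj₂ A-counted))
      rhs = lift (prodF (λ i → α i !)) (proj₁ B-counted) _ (proj₂ (proj₂ B-counted))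
      -- This happens only for a = b = 0: if b is a successor, the constructors of ℤ differ.
      nonneg : ∀ a b → ℤ.+ a ≡ ℤ.- (ℤ.+ b) → a ≡ b
      nonneg a zero e = ℤ.+-injective e
      compare : _ → sumF α ! * proj₁ A-counted ≡ prodF (λ i → α i !) * proj₁ B-counted
      compare (inj₁ e) = ℤ.+-injective (trans lhs (trans e (sym rhs)))
      compare (inj₂ e) = nonneg _ _ (trans lhs (trans e (cong ℤ.-_ (sym rhs))))

  bijection : Bijection (×-setoid (setoid (Fin (sumF α !))) A) (×-setoid (Π-Fin-setoid (λ i → α i !)) B)
  bijection with Fin.all? (λ k → p (inject₁ k) ≤? p (suc k))
  ... | yes p≤ = counted-bijection
    (counted-× (counted-Fin (sumF α !)) (proj₁ (proj₂ (A-counted p≤))))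
    (subst (Counted _) (sym (counts-agree p≤))
      (counted-× (counted-Π (λ i → α i !)) (proj₁ (proj₂ (B-counted p≤)))))
  -- A descent in p leaves no ordering on either side, so both cardinalities are 0.
  ... | no  p≰ = counted-bijection
    (counted-empty (λ (_ , x) → p≰ (A-steps x)))
    (counted-empty (λ (_ , x) → p≰ (B-steps x)))

width-eq : ∀ m → 2 * suc m ∸ 1 ≡ width m
width-eq zero    = refl
width-eq (suc m) = trans (cong (_∸ 1) (ℕ.*-suc 2 (suc m))) (cong (2 +_) (width-eq m))

-- The number of indices is a variable M, so that its equation with `width m` can be matched,
-- although 2n - 1 does not reduce to that form; α and o are carried along.
bijection-of-width : ∀ m {M} → M ≡ width m → (α : Fin M → ℕ) →
  (∀ i k → toℕ i ≡ suc (2 * k) → α i ≡ 1) →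
  (o : Fin (suc m) → Fin M) → (∀ k → toℕ (o k) ≡ 2 * toℕ k) → (p : Fin (suc m) → ℕ) →
  Bijection
    (×-setoid (setoid (Fin (sumF α !)))
      (topoSetoid {Σ (Topo M α) λ t → ∀ k → toℕ (proj₁ t (u (o k))) ≡ p k} (λ x → proj₁ (proj₁ x))))
    (×-setoid (Π-Fin-setoid (λ i → α i !)) (TopoAt (suc m) (λ k → suc (α (o k))) p))
bijection-of-width m refl α α≡1 o toℕ-o p = Comparison.bijection m α
  (λ k → α≡1 (even m k) (toℕ k) (toℕ-even m k)) o
  (λ k → Fin.toℕ-injective (trans (toℕ-o k) (sym (toℕ-odd m k)))) p

theorem2p2 : (n : ℕ) → 1 ≤ n → (α : Fin (2 * n ∸ 1) → ℕ) →
    (∀ (i : Fin (2 * n ∸ 1)) (k : ℕ) → toℕ i ≡ suc (2 * k) → α i ≡ 1) →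
    (p : Fin n → Fin (Ncount n α)) → Injective _≡_ _≡_ p →
    Bijection (×-setoid (setoid (Fin (sumF α !))) (A-setoid n α p))
    (×-setoid (Π-Fin-setoid (λ i → α i !)) (B-setoid n α p))
theorem2p2 (suc m) _ α α≡1 p _ =
  bijection-of-width m (width-eq m) α α≡1 oddIdx (λ k → Fin.toℕ-fromℕ< _) (toℕ ∘ p)
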